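{- Let $q$ be a prime power. Let $S \subseteq \mathbb{F}_{q^2}^*$ with $S=-S$. Assume that $C^6|S|\leq \frac{q^2-3}{2}$, where $C=|SS|/|S|$. If $A\subseteq \mathbb{F}_{q^2}$ is a clique in the Cayley graph $\operatorname{Cay}(\mathbb{F}_{q^2}; S)$ with $|A|=q$ and $0,1\in A$, then $A$ is the subfield $\mathbb{F}_q$ of $\mathbb{F}_{q^2}$.
   Context: $\mathbb{F}_r$ is the finite field with $r$ elements, $\mathbb{F}_r^*=\mathbb{F}_r\setminus\{0\}$, and $\mathbb{F}_q$ is regarded as the unique subfield of order $q$ of $\mathbb{F}_{q^2}$. Here $-S=\{ -s: s\in S\}$ and $SS=\{st: s,t\in S\}$ is the product set. For an abelian group $G$ and $S\subseteq G\setminus\{0\}$ with $S=-S$, the Cayley graph $\operatorname{Cay}(G;S)$ has vertex set $G$, with two vertices adjacent if and only if their difference lies in $S$; here $G$ is the additive group of $\mathbb{F}_{q^2}$. A clique is a set of pairwise adjacent vertices. -}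

module Defs where

open import Algebra.Bundles using (AbelianGroup; CommutativeRing)
open import Algebra.Definitions.RawSemiring using () renaming (_^_ to pow)
open import Data.Fin.Base using (Fin)
open import Data.Fin.Properties using (any?; _≟_)
import Data.Fin.Subset as Sub
open Sub using (Subset; ∣_∣)
open import Data.Fin.Subset.Properties using (_∈?_)
open import Data.Nat.Base using (ℕ; suc; _^_)
open import Data.Nat.Primality using (Prime)
open import Data.Product.Base using (_×_; ∃; ∃₂)
open import Data.Rational.Base using (ℚ; +-*-rawSemiring)
open import Data.Vec.Base using (tabulate)
open import Function.Bundles using (Inverse)
open import Level using (Level; _⊔_) renaming (suc to lsuc)
open import Relation.Binary.Core using (Rel)
open import Relation.Binary.PropositionalEquality using (_≡_; setoid)
open import Relation.Nullary using (¬_; Dec; does; _×-dec_)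
open import Relation.Unary using (Pred)

private
  variable
    a c ℓ p r : Level

IsPrimePower : ℕ → Set
IsPrimePower q = ∃₂ λ p k → Prime p × q ≡ p ^ suc k

infixr 8 _^ℚ_
_^ℚ_ : ℚ → ℕ → ℚ
_^ℚ_ = pow +-*-rawSemiring

Cay : (G : AbelianGroup c ℓ) → Pred (AbelianGroup.Carrier G) p → Rel (AbelianGroup.Carrier G) p
Cay G S x y = S (x ∙ y ⁻¹)
  where open AbelianGroup G using (_∙_; _⁻¹)

IsClique : {V : Set a} (_≈_ : Rel V ℓ) (_~_ : Rel V r) → Pred V p → Set (a ⊔ ℓ ⊔ r ⊔ p)
IsClique _≈_ _~_ A = ∀ {x y} → A x → A y → ¬ (x ≈ y) → x ~ y

record FiniteField c ℓ (n : ℕ) : Set (lsuc (c ⊔ ℓ)) where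
  field
    commutativeRing : CommutativeRing c ℓ

  open CommutativeRing commutativeRing public renaming (setoid to ≈-setoid)

  field
    0≉1         : ¬ (0# ≈ 1#)
    invertible  : ∀ x → ¬ (x ≈ 0#) → ∃ λ y → x * y ≈ 1#
    enumeration : Inverse ≈-setoid (setoid (Fin n))

  index : Carrier → Fin n
  index = Inverse.to enumeration

  element : Fin n → Carrier
  element = Inverse.from enumeration

comprehension : ∀ {n} {P : Pred (Fin n) p} → (∀ i → Dec (P i)) → Subset n
comprehension P? = tabulate λ i → does (P? i)

-- A subset of the field is encoded as a `Subset n` through the enumeration.
-- Equality of subsets is therefore propositional equality, and it coincides
-- with having the same elements.
module _ {n : ℕ} (F : FiniteField c ℓ n) where
  open FiniteField F

  Member : Subset n → Pred Carrier _
  Member S x = index x Sub.∈ S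

  negSet : Subset n → Subset n
  negSet S = comprehension λ i →
    any? λ j → (j ∈? S) ×-dec (i ≟ index (- element j))

  productSet : Subset n → Subset n → Subset n
  productSet S T = comprehension λ i →
    any? λ j → any? λ k →
      (j ∈? S) ×-dec (k ∈? T) ×-dec (i ≟ index (element j * element k))

  record IsSubfield (K : Subset n) : Set (c ⊔ ℓ) where
    field
      0∈K        : Member K 0#
      1∈K        : Member K 1#
      +-closed   : ∀ {x y} → Member K x → Member K y → Member K (x + y)
      neg-closed : ∀ {x} → Member K x → Member K (- x)
      *-closed   : ∀ {x y} → Member K x → Member K y → Member K (x * y)
      inv-closed : ∀ {x y} → Member K x → x * y ≈ 1# → Member K y

  record IsTheSubfieldOfOrder (q : ℕ) (K : Subset n) : Set (c ⊔ ℓ) where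
    field
      isSubfield : IsSubfield K
      order      : ∣ K ∣ ≡ q
      unique     : ∀ L → IsSubfield L → ∣ L ∣ ≡ q → L ≡ K

{-# OPTIONS --safe #-}

-- Put D = SSS / SSS. By the Plünnecke–Ruzsa inequality |D| ≤ C⁶ |S|, so more than half of the elements y of the
-- field lie outside D ∪ {0}. The differences of A lie in S ∪ {0}, and those of 1 / A = {1 / a : a ∈ A \ 0} ∪ {0} lie
-- in S / SS ∪ {0}, because 1 / a - 1 / b = (b - a) / (a b). Hence for B = A or B = 1 / A and y ∉ D ∪ {0} the sums
-- b + y b′ are distinct and exhaust the field, whose elementary symmetric functions e j vanish for 0 < j < q² - 1.
-- As a polynomial in y the function e j (B + y B) has degree at most j; for j < q² / 2 it has too many zeros, thus
-- vanishes at y = 0, where e (i q) of q copies of B is e i (B) ^ q by the Frobenius map. So e i (B) = 0 for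
-- 0 < i < q / 2. Since e i (1 / A) is e (q - 1 - i) (A) up to a nonzero factor, all e i (A) with 0 < i < q - 1 vanish,
-- so the nodal polynomial of A is X ^ q - X.
module Submission where

open import Defs

open import Algebra.Bundles using (CommutativeRing; RawRing)
open import Algebra.Core using (Op₁; Op₂)
import Algebra.Morphism.RingMonomorphism as RingMonomorphism
open import Algebra.Morphism.Structures using (IsRingMonomorphism)
open import Algebra.Structures using (IsCommutativeMonoid; IsCommutativeRing; IsCommutativeSemigroup)
open import Data.Fin.Base using (Fin; zero; suc)
open import Data.Fin.Properties using (any?; suc-injective) renaming (_≟_ to _≟ᶠ_)
open import Data.Fin.Subset using (Subset; ∣_∣; _∪_; _∩_; ∁; ⁅_⁆; inside; outside)
import Data.Fin.Subset as Sub
import Data.Fin.Subset.Properties as Sub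
import Data.Integer.Base as ℤ
import Data.Integer.Properties as ℤ
open import Data.List.Base
  using (List; []; _∷_; _++_; length; map; foldr; replicate; concatMap; cartesianProduct; allFin)
open import Data.List.Membership.Propositional using (_∈_; _∉_)
open import Data.List.Membership.Propositional.Properties
  using (∈-∃++; ∈-map⁺; ∈-map⁻; ∈-cartesianProduct⁺; ∈-cartesianProduct⁻; ∈-allFin)
open import Data.List.Properties using (length-map; length-++; length-tabulate; ++-identityʳ; map-++)
open import Data.List.Relation.Binary.Permutation.Propositional
  using (_↭_; refl; prep; swap; trans; ↭-refl; ↭-sym; ↭⇒↭ₛ)
open import Data.List.Relation.Binary.Permutation.Propositional.Properties
  using (↭-length; shift; ∈-resp-↭) renaming (map⁺ to ↭-map⁺)
open import Data.List.Relation.Binary.Subset.Propositional using (_⊆_)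
import Data.List.Relation.Unary.All as All
open import Data.List.Relation.Unary.All.Properties using (¬Any⇒All¬)
open import Data.List.Relation.Unary.AllPairs using ([]; _∷_)
open import Data.List.Relation.Unary.Any using (here; there)
open import Data.List.Relation.Unary.Unique.Propositional using (Unique)
open import Data.List.Relation.Unary.Unique.Propositional.Properties
  using (allFin⁺; cartesianProduct⁺; Unique[x∷xs]⇒x∉xs) renaming (map⁺ to Unique-map⁺)
open import Data.Nat.Base as ℕ using (ℕ; zero; suc; z≤n; s≤s)
open import Data.Nat.Coprimality using (prime⇒coprime; coprime-Bézout)
open import Data.Nat.GCD using (module Bézout)
open import Data.Nat.Induction using (<-wellFounded; Acc; acc)
open import Data.Nat.Primality using (Prime; ¬prime[0])
import Data.Nat.Properties as ℕ
open import Data.Nat.Solver using (module +-*-Solver)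
open import Data.Product.Base using (∃; ∃₂; _×_; _,_; proj₁; proj₂)
import Data.Rational.Base as ℚ
import Data.Rational.Properties as ℚ
import Data.Rational.Unnormalised.Base as ℚᵘ
import Data.Rational.Unnormalised.Properties as ℚᵘ
open import Data.Sum.Base using (inj₁; inj₂)
open import Data.Vec.Base using ([]; _∷_)
import Data.Vec.Base as Vec
open import Data.Vec.Properties using (lookup∘tabulate; lookup⇒[]=; []=⇒lookup)
open import Function.Base using (_∘_; const; id)
open import Function.Bundles using (Inverse)
open import Level using (Level; 0ℓ)
open import Relation.Binary.Definitions using (DecidableEquality)
open import Relation.Binary.PropositionalEquality as ≡
  using (_≡_; _≢_; _≗_; refl; sym; cong; cong₂; subst; subst₂)
open import Relation.Nullary using (¬_; Dec; yes; no; does; contradiction; _×-dec_)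
open import Relation.Nullary.Decidable using (dec-true)
open import Relation.Unary using (Pred)

-- The exponent 6 is forced by inversion. A quotient y of two differences of A lies in S / S, which
-- becomes part of D after multiplication by s s / s s. For 1 / A the two differences have
-- denominators r and r′ in SS, so y is a quotient of two products of three elements, and the
-- product-set bound for SSS enters squared. Passing to 1 / A cannot be avoided: the degree i q has
-- to stay below the number of admissible y, of which only slightly more than half of q² are
-- guaranteed, so A alone yields just the lower half of its symmetric functions. No polynomial ring
-- is formed. A degree bound is a property of a function, certified by iterated difference
-- quotients, and this is all that counting zeros consumes. Elementary symmetric functions are used
-- instead of power sums because recovering coefficients from power sums would require division by
-- integers that vanish in characteristic p. Once the e i vanish, x ^ (q - 1) is constant on the
-- nonzero elements of A. Since 1 is one of them, A consists of fixed points of x ^ q, and counting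
-- zeros shows that it contains all of them.

private
  variable
    X Y : Set
    n   : ℕ

-- Lists without repetition

∈⇒↭∷ : ∀ {x : X} {xs} → x ∈ xs → ∃ λ ys → xs ↭ x ∷ ys
∈⇒↭∷ x∈xs with ∈-∃++ x∈xs
... | ys , zs , refl = ys ++ zs , shift _ ys zs

∈-∷⁻ : ∀ {x y : X} {xs} → x ∈ y ∷ xs → x ≢ y → x ∈ xs
∈-∷⁻ (here x≡y)   x≢y = contradiction x≡y x≢y
∈-∷⁻ (there x∈xs) _   = x∈xs

-- Each `x` is moved to the front of `ys` and removed. The inclusion of the rest survives because no
-- later entry equals `x`. All cardinality comparisons rest on this.
Unique-⊆⇒↭++ : ∀ {xs ys : List X} → Unique xs → xs ⊆ ys → ∃ λ zs → ys ↭ xs ++ zs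
Unique-⊆⇒↭++ {xs = []}     {ys} _            _     = ys , ↭-refl
Unique-⊆⇒↭++ {xs = x ∷ xs} {ys} (x∉xs ∷ xs!) xs⊆ys with ∈⇒↭∷ (xs⊆ys (here refl))
... | ys′ , ys↭ with Unique-⊆⇒↭++ xs! (λ z∈xs →
      ∈-∷⁻ (∈-resp-↭ ys↭ (xs⊆ys (there z∈xs))) λ { refl → All.lookup x∉xs z∈xs refl })
... | zs , ys′↭ = zs , trans ys↭ (prep x ys′↭)

Unique-⊆⇒length≤ : ∀ {xs ys : List X} → Unique xs → xs ⊆ ys → length xs ℕ.≤ length ys
Unique-⊆⇒length≤ {xs = xs} xs! xs⊆ys with Unique-⊆⇒↭++ xs! xs⊆ys
... | zs , ys↭ = subst (length xs ℕ.≤_) (sym (≡.trans (↭-length ys↭) (length-++ xs))) (ℕ.m≤m+n _ _)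

-- A surplus entry would contradict the length bound. Applied to an injective self-map of a finite
-- set, this gives a permutation, under which `e` is invariant.
Unique-⊆⇒↭ : ∀ {xs ys : List X} → Unique xs → xs ⊆ ys → length ys ℕ.≤ length xs → xs ↭ ys
Unique-⊆⇒↭ {xs = xs} {ys} xs! xs⊆ys ys≤xs with Unique-⊆⇒↭++ xs! xs⊆ys
... | []     , ys↭ = ↭-sym (subst (ys ↭_) (++-identityʳ xs) ys↭)
... | z ∷ zs , ys↭ = contradiction ys≤xs (ℕ.<⇒≱ (subst (length xs ℕ.<_)
  (sym (≡.trans (↭-length ys↭) (length-++ xs))) (ℕ.m<m+n _ (s≤s z≤n))))

Unique-map : ∀ {f : X → Y} {xs} → (∀ {x y} → x ∈ xs → y ∈ xs → f x ≡ f y → x ≡ y) → Unique xs → Unique (map f xs)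
Unique-map {xs = []}     inj _            = []
Unique-map {f = f} {xs = x ∷ xs} inj (x∉xs ∷ xs!) =
  ¬Any⇒All¬ _ fx∉ ∷ Unique-map (λ x∈ y∈ → inj (there x∈) (there y∈)) xs!
  where
  fx∉ : f x ∉ map f xs
  fx∉ fx∈ with ∈-map⁻ f fx∈
  ... | y , y∈xs , fx≡fy = All.lookup x∉xs y∈xs (inj (here refl) (there y∈xs) fx≡fy)

Unique-resp-↭ : ∀ {xs ys : List X} → xs ↭ ys → Unique xs → Unique ys
Unique-resp-↭ {X = X} xs↭ys = Perm.Unique-resp-↭ (↭⇒↭ₛ xs↭ys)
  where import Data.List.Relation.Binary.Permutation.Setoid.Properties (≡.setoid X) as Perm

length-cartesianProduct : ∀ {X Y : Set} (xs : List X) (ys : List Y) →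
  length (cartesianProduct xs ys) ≡ length xs ℕ.* length ys
length-cartesianProduct []       ys = refl
length-cartesianProduct (x ∷ xs) ys = ≡.trans (length-++ (map (x ,_) ys))
  (cong₂ ℕ._+_ (length-map (x ,_) ys) (length-cartesianProduct xs ys))

-- Subsets of Fin n

∈-comprehension⁺ : ∀ {p} {P : Pred (Fin n) p} (P? : ∀ i → Dec (P i)) {i} → P i → i Sub.∈ comprehension P?
∈-comprehension⁺ P? {i} Pi = lookup⇒[]= i _ (≡.trans (lookup∘tabulate _ i) (dec-true (P? i) Pi))

∈-comprehension⁻ : ∀ {p} {P : Pred (Fin n) p} (P? : ∀ i → Dec (P i)) {i} → i Sub.∈ comprehension P? → P i
∈-comprehension⁻ P? {i} i∈ with P? i | ≡.trans (sym (lookup∘tabulate (does ∘ P?) i)) ([]=⇒lookup i∈)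
... | yes Pi | _ = Pi

toList : Subset n → List (Fin n)
toList []            = []
toList (inside  ∷ p) = zero ∷ map suc (toList p)
toList (outside ∷ p) = map suc (toList p)

length-toList : (p : Subset n) → length (toList p) ≡ ∣ p ∣
length-toList []            = refl
length-toList (inside  ∷ p) = cong suc (≡.trans (length-map suc (toList p)) (length-toList p))
length-toList (outside ∷ p) = ≡.trans (length-map suc (toList p)) (length-toList p)

toList-Unique : (p : Subset n) → Unique (toList p)
toList-Unique []            = []
toList-Unique (inside  ∷ p) =
  ¬Any⇒All¬ _ (λ 0∈ → 0≢suc (proj₂ (proj₂ (∈-map⁻ suc 0∈)))) ∷ Unique-map⁺ suc-injective (toList-Unique p)
  where
  0≢suc : ∀ {i : Fin n} → Fin.zero ≢ suc i
  0≢suc ()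
toList-Unique (outside ∷ p) = Unique-map⁺ suc-injective (toList-Unique p)

∈-toList⁺ : ∀ {p : Subset n} {i} → i Sub.∈ p → i ∈ toList p
∈-toList⁺ {p = inside  ∷ p} {zero}  i∈             = here refl
∈-toList⁺ {p = inside  ∷ p} {suc i} (Vec.there i∈) = there (∈-map⁺ suc (∈-toList⁺ i∈))
∈-toList⁺ {p = outside ∷ p} {suc i} (Vec.there i∈) = ∈-map⁺ suc (∈-toList⁺ i∈)

∈-toList⁻ : ∀ (p : Subset n) {i} → i ∈ toList p → i Sub.∈ p
∈-toList⁻ (inside  ∷ p) (here refl) = Vec.here
∈-toList⁻ (inside  ∷ p) (there i∈)  with ∈-map⁻ suc i∈
... | j , j∈ , refl = Vec.there (∈-toList⁻ p j∈)
∈-toList⁻ (outside ∷ p) i∈          with ∈-map⁻ suc i∈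
... | j , j∈ , refl = Vec.there (∈-toList⁻ p j∈)

-- Presents a subset as built up one element at a time, the form on which Petridis' induction runs.
fromList : List (Fin n) → Subset n
fromList = foldr (λ i p → ⁅ i ⁆ ∪ p) Sub.⊥

∈-fromList⁺ : ∀ {xs} {i : Fin n} → i ∈ xs → i Sub.∈ fromList xs
∈-fromList⁺ (here refl) = Sub.p⊆p∪q _ (Sub.x∈⁅x⁆ _)
∈-fromList⁺ (there i∈)  = Sub.q⊆p∪q _ _ (∈-fromList⁺ i∈)

∈-fromList⁻ : ∀ xs {i : Fin n} → i Sub.∈ fromList xs → i ∈ xs
∈-fromList⁻ []       i∈ = contradiction i∈ Sub.∉⊥
∈-fromList⁻ (x ∷ xs) i∈ with Sub.x∈p∪q⁻ ⁅ x ⁆ (fromList xs) i∈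
... | inj₁ i∈x  = here (Sub.x∈⁅y⁆⇒x≡y x i∈x)
... | inj₂ i∈xs = there (∈-fromList⁻ xs i∈xs)

fromList-toList : (p : Subset n) → fromList (toList p) ≡ p
fromList-toList p = Sub.⊆-antisym (∈-toList⁻ p ∘ ∈-fromList⁻ _) (∈-fromList⁺ ∘ ∈-toList⁺)

∣p∪q∣+∣p∩q∣ : (p q : Subset n) → ∣ p ∪ q ∣ ℕ.+ ∣ p ∩ q ∣ ≡ ∣ p ∣ ℕ.+ ∣ q ∣
∣p∪q∣+∣p∩q∣ []            []            = refl
∣p∪q∣+∣p∩q∣ (inside  ∷ p) (inside  ∷ q) =
  cong suc (≡.trans (ℕ.+-suc _ _) (≡.trans (cong suc (∣p∪q∣+∣p∩q∣ p q)) (sym (ℕ.+-suc _ _))))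
∣p∪q∣+∣p∩q∣ (inside  ∷ p) (outside ∷ q) = cong suc (∣p∪q∣+∣p∩q∣ p q)
∣p∪q∣+∣p∩q∣ (outside ∷ p) (inside  ∷ q) = ≡.trans (cong suc (∣p∪q∣+∣p∩q∣ p q)) (sym (ℕ.+-suc _ _))
∣p∪q∣+∣p∩q∣ (outside ∷ p) (outside ∷ q) = ∣p∪q∣+∣p∩q∣ p q

p⊆q∧∣q∣≤∣p∣⇒p≡q : ∀ {p q : Subset n} → p Sub.⊆ q → ∣ q ∣ ℕ.≤ ∣ p ∣ → p ≡ q
p⊆q∧∣q∣≤∣p∣⇒p≡q {p = p} {q} p⊆q ∣q∣≤∣p∣ = Sub.⊆-antisym p⊆q
  (∈-toList⁻ p ∘ ∈-resp-↭ (↭-sym p↭q) ∘ ∈-toList⁺)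
  where
  p↭q : toList p ↭ toList q
  p↭q = Unique-⊆⇒↭ (toList-Unique p) (∈-toList⁺ ∘ p⊆q ∘ ∈-toList⁻ p)
    (subst₂ ℕ._≤_ (sym (length-toList q)) (sym (length-toList p)) ∣q∣≤∣p∣)

-- Plünnecke–Ruzsa inequality

module ProductSets {n : ℕ} {_·_ : Op₂ (Fin n)} (isCommutativeSemigroup : IsCommutativeSemigroup _≡_ _·_) where

  open IsCommutativeSemigroup isCommutativeSemigroup using (assoc; comm)

  infixl 7 _⊙_

  IsProduct : Subset n → Subset n → Fin n → Set
  IsProduct P Q z = ∃₂ λ x y → x Sub.∈ P × y Sub.∈ Q × z ≡ x · y

  isProduct? : ∀ P Q z → Dec (IsProduct P Q z)
  isProduct? P Q z = any? λ x → any? λ y →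
    (x Sub.∈? P) ×-dec (y Sub.∈? Q) ×-dec (z ≟ᶠ (x · y))

  _⊙_ : Subset n → Subset n → Subset n
  P ⊙ Q = comprehension (isProduct? P Q)

  ∈-⊙⁺ : ∀ {P Q x y} → x Sub.∈ P → y Sub.∈ Q → (x · y) Sub.∈ P ⊙ Q
  ∈-⊙⁺ {P} {Q} x∈ y∈ = ∈-comprehension⁺ (isProduct? P Q) (_ , _ , x∈ , y∈ , refl)

  ∈-⊙⁻ : ∀ P Q {z} → z Sub.∈ P ⊙ Q → IsProduct P Q z
  ∈-⊙⁻ P Q = ∈-comprehension⁻ (isProduct? P Q)

  ⊙-monoˡ : ∀ {P P′} Q → P Sub.⊆ P′ → P ⊙ Q Sub.⊆ P′ ⊙ Q
  ⊙-monoˡ {P} Q P⊆P′ z∈ with ∈-⊙⁻ P Q z∈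
  ... | x , y , x∈ , y∈ , refl = ∈-⊙⁺ (P⊆P′ x∈) y∈

  ⊙-comm-⊆ : ∀ P Q → P ⊙ Q Sub.⊆ Q ⊙ P
  ⊙-comm-⊆ P Q z∈ with ∈-⊙⁻ P Q z∈
  ... | x , y , x∈ , y∈ , refl = subst (Sub._∈ Q ⊙ P) (comm y x) (∈-⊙⁺ y∈ x∈)

  ⊙-comm : ∀ P Q → P ⊙ Q ≡ Q ⊙ P
  ⊙-comm P Q = Sub.⊆-antisym (⊙-comm-⊆ P Q) (⊙-comm-⊆ Q P)

  ⊙-assoc : ∀ P Q R → (P ⊙ Q) ⊙ R ≡ P ⊙ (Q ⊙ R)
  ⊙-assoc P Q R = Sub.⊆-antisym to from
    where
    to : (P ⊙ Q) ⊙ R Sub.⊆ P ⊙ (Q ⊙ R)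
    to w∈ with ∈-⊙⁻ (P ⊙ Q) R w∈
    ... | _ , z , xy∈ , z∈ , refl with ∈-⊙⁻ P Q xy∈
    ... | x , y , x∈ , y∈ , refl = subst (Sub._∈ P ⊙ (Q ⊙ R)) (sym (assoc x y z)) (∈-⊙⁺ x∈ (∈-⊙⁺ y∈ z∈))
    from : P ⊙ (Q ⊙ R) Sub.⊆ (P ⊙ Q) ⊙ R
    from w∈ with ∈-⊙⁻ P (Q ⊙ R) w∈
    ... | x , _ , x∈ , yz∈ , refl with ∈-⊙⁻ Q R yz∈
    ... | y , z , y∈ , z∈ , refl = subst (Sub._∈ (P ⊙ Q) ⊙ R) (assoc x y z) (∈-⊙⁺ (∈-⊙⁺ x∈ y∈) z∈)

  ⊙-distribˡ-∪ : ∀ P Q R → P ⊙ (Q ∪ R) ≡ P ⊙ R ∪ P ⊙ Q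
  ⊙-distribˡ-∪ P Q R = Sub.⊆-antisym to from
    where
    to : P ⊙ (Q ∪ R) Sub.⊆ P ⊙ R ∪ P ⊙ Q
    to z∈ with ∈-⊙⁻ P (Q ∪ R) z∈
    ... | x , y , x∈ , y∈ , refl with Sub.x∈p∪q⁻ Q R y∈
    ... | inj₁ y∈Q = Sub.q⊆p∪q (P ⊙ R) _ (∈-⊙⁺ x∈ y∈Q)
    ... | inj₂ y∈R = Sub.p⊆p∪q (P ⊙ Q) (∈-⊙⁺ x∈ y∈R)
    from : P ⊙ R ∪ P ⊙ Q Sub.⊆ P ⊙ (Q ∪ R)
    from z∈ with Sub.x∈p∪q⁻ (P ⊙ R) (P ⊙ Q) z∈
    ... | inj₁ z∈R with ∈-⊙⁻ P R z∈R
    ...   | x , y , x∈ , y∈ , refl = ∈-⊙⁺ x∈ (Sub.q⊆p∪q Q R y∈)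
    from z∈ | inj₂ z∈Q with ∈-⊙⁻ P Q z∈Q
    ...   | x , y , x∈ , y∈ , refl = ∈-⊙⁺ x∈ (Sub.p⊆p∪q R y∈)

  -- Cancellation is required elementwise because the multiplicative semigroup of a field contains
  -- 0.
  Cancellable : Fin n → Set
  Cancellable c = ∀ {x y} → x · c ≡ y · c → x ≡ y

  ·-cancellable : ∀ {b c} → Cancellable b → Cancellable c → Cancellable (b · c)
  ·-cancellable {b} {c} cancel-b cancel-c {x} {y} eq =
    cancel-b (cancel-c (≡.trans (assoc x b c) (≡.trans eq (sym (assoc y b c)))))

  ⊙-cancellable : ∀ {P Q} → (∀ {x} → x Sub.∈ P → Cancellable x) → (∀ {x} → x Sub.∈ Q → Cancellable x) →
    ∀ {z} → z Sub.∈ P ⊙ Q → Cancellable z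
  ⊙-cancellable {P} {Q} cP cQ {z} z∈ with ∈-⊙⁻ P Q z∈
  ... | x , y , x∈ , y∈ , refl = ·-cancellable (cP x∈) (cQ y∈)

  ∣P⊙⁅b⁆∣≤∣P∣ : ∀ P b → ∣ P ⊙ ⁅ b ⁆ ∣ ℕ.≤ ∣ P ∣
  ∣P⊙⁅b⁆∣≤∣P∣ P b = subst₂ ℕ._≤_ (length-toList (P ⊙ ⁅ b ⁆)) (≡.trans (length-map (_· b) (toList P)) (length-toList P))
    (Unique-⊆⇒length≤ (toList-Unique (P ⊙ ⁅ b ⁆)) sub)
    where
    sub : ∀ {z} → z ∈ toList (P ⊙ ⁅ b ⁆) → z ∈ map (_· b) (toList P)
    sub z∈ with ∈-⊙⁻ P ⁅ b ⁆ (∈-toList⁻ _ z∈)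
    ... | x , y , x∈ , y∈ , refl with Sub.x∈⁅y⁆⇒x≡y b y∈
    ... | refl = ∈-map⁺ (_· b) (∈-toList⁺ x∈)

  ∣P∣≤∣P⊙⁅b⁆∣ : ∀ P {b} → Cancellable b → ∣ P ∣ ℕ.≤ ∣ P ⊙ ⁅ b ⁆ ∣
  ∣P∣≤∣P⊙⁅b⁆∣ P {b} cancel-b =
    subst₂ ℕ._≤_ (≡.trans (length-map (_· b) (toList P)) (length-toList P)) (length-toList (P ⊙ ⁅ b ⁆))
    (Unique-⊆⇒length≤ (Unique-map (λ _ _ → cancel-b) (toList-Unique P)) sub)
    where
    sub : ∀ {z} → z ∈ map (_· b) (toList P) → z ∈ toList (P ⊙ ⁅ b ⁆)
    sub z∈ with ∈-map⁻ (_· b) z∈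
    ... | x , x∈ , refl = ∈-toList⁺ (∈-⊙⁺ (∈-toList⁻ P x∈) (Sub.x∈⁅x⁆ b))

  -- X minimises |Z S| / |Z| among its own subsets.
  Minimal : Subset n → Subset n → Set
  Minimal S X = ∀ Z → Z Sub.⊆ X → ∣ X ⊙ S ∣ ℕ.* ∣ Z ∣ ℕ.≤ ∣ Z ⊙ S ∣ ℕ.* ∣ X ∣

  -- Descent on `∣ X ∣`: a subset with strictly smaller ratio is nonempty and proper, so it can
  -- replace `X`. Ratios are compared by cross-multiplication, and transitivity follows by
  -- cancelling the middle cardinality.
  minimal-exists : ∀ S X → 0 ℕ.< ∣ X ∣ →
    ∃ λ Z → Z Sub.⊆ X × 0 ℕ.< ∣ Z ∣ × Minimal S Z × ∣ Z ⊙ S ∣ ℕ.* ∣ X ∣ ℕ.≤ ∣ X ⊙ S ∣ ℕ.* ∣ Z ∣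
  minimal-exists S X = go X (<-wellFounded ∣ X ∣)
    where
    go : ∀ X → Acc ℕ._<_ ∣ X ∣ → 0 ℕ.< ∣ X ∣ →
      ∃ λ Z → Z Sub.⊆ X × 0 ℕ.< ∣ Z ∣ × Minimal S Z × ∣ Z ⊙ S ∣ ℕ.* ∣ X ∣ ℕ.≤ ∣ X ⊙ S ∣ ℕ.* ∣ Z ∣
    go X (acc rec) 0<X with Sub.anySubset? (λ Z → (Z Sub.⊆? X) ×-dec (∣ Z ⊙ S ∣ ℕ.* ∣ X ∣ ℕ.<? ∣ X ⊙ S ∣ ℕ.* ∣ Z ∣))
    ... | no none = X , id , 0<X , (λ Z Z⊆X → ℕ.≮⇒≥ λ lt → none (Z , Z⊆X , lt)) , ℕ.≤-refl
    ... | yes (Y , Y⊆X , lt) with go Y (rec Y<X) 0<Y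
      where
      0<Y : 0 ℕ.< ∣ Y ∣
      0<Y = ℕ.n≢0⇒n>0 λ Y≡0 → ℕ.n≮0 (subst
        (∣ Y ⊙ S ∣ ℕ.* ∣ X ∣ ℕ.<_) (≡.trans (cong (∣ X ⊙ S ∣ ℕ.*_) Y≡0) (ℕ.*-zeroʳ ∣ X ⊙ S ∣)) lt)
      Y<X : ∣ Y ∣ ℕ.< ∣ X ∣
      Y<X = ℕ.≰⇒> λ X≤Y → ℕ.<-irrefl (cong (λ Z → ∣ Z ⊙ S ∣ ℕ.* ∣ X ∣) (p⊆q∧∣q∣≤∣p∣⇒p≡q Y⊆X X≤Y))
        (subst (λ Z → ∣ Y ⊙ S ∣ ℕ.* ∣ X ∣ ℕ.< ∣ X ⊙ S ∣ ℕ.* ∣ Z ∣) (p⊆q∧∣q∣≤∣p∣⇒p≡q Y⊆X X≤Y) lt)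
    ... | Z , Z⊆Y , 0<Z , minimal , ratio = Z , Y⊆X ∘ Z⊆Y , 0<Z , minimal ,
      ℕ.*-cancelʳ-≤ _ _ ∣ Y ∣ {{ℕ.>-nonZero 0<Y}} (begin
        (zs ℕ.* x) ℕ.* y   ≡⟨ solve 3 (λ a b c → a :* b :* c := (a :* c) :* b) refl zs x y ⟩
        (zs ℕ.* y) ℕ.* x   ≤⟨ ℕ.*-monoˡ-≤ x ratio ⟩
        (ys ℕ.* z) ℕ.* x   ≡⟨ solve 3 (λ a b c → a :* b :* c := (a :* c) :* b) refl ys z x ⟩
        (ys ℕ.* x) ℕ.* z   ≤⟨ ℕ.*-monoˡ-≤ z (ℕ.<⇒≤ lt) ⟩
        (xs ℕ.* y) ℕ.* z   ≡⟨ solve 3 (λ a b c → a :* b :* c := (a :* c) :* b) refl xs y z ⟩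
        (xs ℕ.* z) ℕ.* y   ∎)
      where
      open ℕ.≤-Reasoning
      open +-*-Solver
      0<Y : 0 ℕ.< ∣ Y ∣
      0<Y = ℕ.<-≤-trans 0<Z (Sub.p⊆q⇒∣p∣≤∣q∣ Z⊆Y)
      x = ∣ X ∣
      y = ∣ Y ∣
      z = ∣ Z ∣
      xs = ∣ X ⊙ S ∣
      ys = ∣ Y ⊙ S ∣
      zs = ∣ Z ⊙ S ∣

  -- Petridis' induction: adding b to T, the elements x of X with x b ∈ X T contribute nothing new.
  petridis : ∀ {S X} T → Minimal S X → (∀ {t} → t Sub.∈ T → Cancellable t) →
    ∣ X ⊙ S ⊙ T ∣ ℕ.* ∣ X ∣ ℕ.≤ ∣ X ⊙ S ∣ ℕ.* ∣ X ⊙ T ∣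
  petridis {S} {X} T minimal cancel =
    subst (λ T → ∣ X ⊙ S ⊙ T ∣ ℕ.* ∣ X ∣ ℕ.≤ ∣ X ⊙ S ∣ ℕ.* ∣ X ⊙ T ∣) (fromList-toList T)
    (go (toList T) (cancel ∘ ∈-toList⁻ T))
    where
    open ℕ.≤-Reasoning
    go : ∀ bs → (∀ {b} → b ∈ bs → Cancellable b) →
      ∣ X ⊙ S ⊙ fromList bs ∣ ℕ.* ∣ X ∣ ℕ.≤ ∣ X ⊙ S ∣ ℕ.* ∣ X ⊙ fromList bs ∣
    go []       _       = subst (λ m → m ℕ.* ∣ X ∣ ℕ.≤ ∣ X ⊙ S ∣ ℕ.* ∣ X ⊙ Sub.⊥ ∣) (sym empty) z≤n
      where
      empty : ∣ X ⊙ S ⊙ Sub.⊥ ∣ ≡ 0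
      empty = ≡.trans (cong ∣_∣ (Sub.Empty-unique λ (z , z∈) →
        let _ , _ , _ , y∈ , _ = ∈-⊙⁻ (X ⊙ S) Sub.⊥ z∈ in Sub.∉⊥ y∈)) (Sub.∣⊥∣≡0 n)
    go (b ∷ bs) cancels = subst₂ (λ P Q → ∣ P ∣ ℕ.* x ℕ.≤ xs ℕ.* ∣ Q ∣)
      (sym (⊙-distribˡ-∪ (X ⊙ S) ⁅ b ⁆ (fromList bs))) (sym (⊙-distribˡ-∪ X ⁅ b ⁆ (fromList bs)))
      -- The added term replaces a subtraction: on the left it is absorbed by the overlap of `U` and
      -- `V`, on the right minimality of `X` brings it back from `xs * ∣ W ∣`.
      (ℕ.+-cancelʳ-≤ (∣ W ⊙ S ∣ ℕ.* x) _ _ (begin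
        ∣ U ∪ V ∣ ℕ.* x ℕ.+ ∣ W ⊙ S ∣ ℕ.* x      ≡⟨ ℕ.*-distribʳ-+ x ∣ U ∪ V ∣ _ ⟨
        (∣ U ∪ V ∣ ℕ.+ ∣ W ⊙ S ∣) ℕ.* x          ≤⟨ ℕ.*-monoˡ-≤ x (ℕ.+-monoʳ-≤ ∣ U ∪ V ∣ WS≤) ⟩
        (∣ U ∪ V ∣ ℕ.+ ∣ U ∩ V ∣) ℕ.* x          ≡⟨ cong (ℕ._* x) (∣p∪q∣+∣p∩q∣ U V) ⟩
        (∣ U ∣ ℕ.+ ∣ V ∣) ℕ.* x                  ≤⟨ ℕ.*-monoˡ-≤ x (ℕ.+-monoʳ-≤ ∣ U ∣ (∣P⊙⁅b⁆∣≤∣P∣ (X ⊙ S) b)) ⟩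
        (∣ U ∣ ℕ.+ xs) ℕ.* x                     ≡⟨ ℕ.*-distribʳ-+ x ∣ U ∣ xs ⟩
        ∣ U ∣ ℕ.* x ℕ.+ xs ℕ.* x
          ≤⟨ ℕ.+-mono-≤ (go bs (cancels ∘ there)) (ℕ.*-monoʳ-≤ xs (∣P∣≤∣P⊙⁅b⁆∣ X (cancels (here refl)))) ⟩
        xs ℕ.* ∣ U′ ∣ ℕ.+ xs ℕ.* ∣ V′ ∣          ≡⟨ ℕ.*-distribˡ-+ xs ∣ U′ ∣ ∣ V′ ∣ ⟨
        xs ℕ.* (∣ U′ ∣ ℕ.+ ∣ V′ ∣)               ≡⟨ cong (xs ℕ.*_) (∣p∪q∣+∣p∩q∣ U′ V′) ⟨
        xs ℕ.* (∣ U′ ∪ V′ ∣ ℕ.+ ∣ U′ ∩ V′ ∣)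
          ≤⟨ ℕ.*-monoʳ-≤ xs (ℕ.+-monoʳ-≤ ∣ U′ ∪ V′ ∣ (ℕ.≤-trans (Sub.p⊆q⇒∣p∣≤∣q∣ ⊆Wb) (∣P⊙⁅b⁆∣≤∣P∣ W b))) ⟩
        xs ℕ.* (∣ U′ ∪ V′ ∣ ℕ.+ ∣ W ∣)           ≡⟨ ℕ.*-distribˡ-+ xs ∣ U′ ∪ V′ ∣ ∣ W ∣ ⟩
        xs ℕ.* ∣ U′ ∪ V′ ∣ ℕ.+ xs ℕ.* ∣ W ∣      ≤⟨ ℕ.+-monoʳ-≤ (xs ℕ.* ∣ U′ ∪ V′ ∣) (minimal W W⊆X) ⟩
        xs ℕ.* ∣ U′ ∪ V′ ∣ ℕ.+ ∣ W ⊙ S ∣ ℕ.* x   ∎))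
      where
      x  = ∣ X ∣
      xs = ∣ X ⊙ S ∣
      B = fromList bs
      U  = X ⊙ S ⊙ B
      V  = X ⊙ S ⊙ ⁅ b ⁆
      U′ = X ⊙ B
      V′ = X ⊙ ⁅ b ⁆
      W? : ∀ i → Dec (i Sub.∈ X × (i · b) Sub.∈ U′)
      W? i = (i Sub.∈? X) ×-dec ((i · b) Sub.∈? U′)
      W = comprehension W?
      W⊆X : W Sub.⊆ X
      W⊆X = proj₁ ∘ ∈-comprehension⁻ W?
      exchange : ∀ x y z → (x · y) · z ≡ (x · z) · y
      exchange x y z = ≡.trans (assoc x y z) (≡.trans (cong (x ·_) (comm y z)) (sym (assoc x z y)))
      -- If `w b = x t` with `t` in `B`, then `w s b = x s t`, so this part of `X S b` is already in
      -- `X S B`.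
      WSb⊆U∩V : W ⊙ S ⊙ ⁅ b ⁆ Sub.⊆ U ∩ V
      WSb⊆U∩V z∈ = Sub.x∈p∩q⁺ (in-U z∈ , ⊙-monoˡ ⁅ b ⁆ (⊙-monoˡ S W⊆X) z∈)
        where
        in-U : W ⊙ S ⊙ ⁅ b ⁆ Sub.⊆ U
        in-U z∈ with ∈-⊙⁻ (W ⊙ S) ⁅ b ⁆ z∈
        ... | _ , _ , ws∈ , b∈ , refl with ∈-⊙⁻ W S ws∈ | Sub.x∈⁅y⁆⇒x≡y b b∈
        ... | w , s , w∈ , s∈ , refl | refl with ∈-⊙⁻ X B (proj₂ (∈-comprehension⁻ W? w∈))
        ... | x , t , x∈ , t∈ , wb≡xt = subst (Sub._∈ U)
          (≡.trans (exchange x s t) (≡.trans (cong (_· s) (sym wb≡xt)) (exchange w b s))) (∈-⊙⁺ (∈-⊙⁺ x∈ s∈) t∈)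
      WS≤ : ∣ W ⊙ S ∣ ℕ.≤ ∣ U ∩ V ∣
      WS≤ = ℕ.≤-trans (∣P∣≤∣P⊙⁅b⁆∣ (W ⊙ S) (cancels (here refl))) (Sub.p⊆q⇒∣p∣≤∣q∣ WSb⊆U∩V)
      ⊆Wb : U′ ∩ V′ Sub.⊆ W ⊙ ⁅ b ⁆
      ⊆Wb z∈ with Sub.x∈p∩q⁻ U′ V′ z∈
      ... | z∈U′ , z∈V′ with ∈-⊙⁻ X ⁅ b ⁆ z∈V′
      ... | x , y , x∈ , y∈ , refl with Sub.x∈⁅y⁆⇒x≡y b y∈
      ... | refl = ∈-⊙⁺ (∈-comprehension⁺ W? (x∈ , z∈U′)) y∈

  -- The set `T / T`, expressed without inverses.
  IsQuotient : Subset n → Fin n → Set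
  IsQuotient T d = ∃ λ t → t Sub.∈ T × (d · t) Sub.∈ T

  isQuotient? : ∀ T d → Dec (IsQuotient T d)
  isQuotient? T d = any? λ t → (t Sub.∈? T) ×-dec ((d · t) Sub.∈? T)

  quotients : Subset n → Subset n
  quotients T = comprehension (isQuotient? T)

  -- The pair `(x , d)` goes to `(x t , x d t)`, with a denominator `t` of `d` fixed in advance. The
  -- quotient of the two coordinates recovers `d`, which determines `t`, and then `x` is obtained by
  -- cancellation.
  ruzsa : ∀ X T → (∀ {x} → x Sub.∈ X → Cancellable x) → (∀ {t} → t Sub.∈ T → Cancellable t) →
    ∣ X ∣ ℕ.* ∣ quotients T ∣ ℕ.≤ ∣ X ⊙ T ∣ ℕ.* ∣ X ⊙ T ∣
  ruzsa X T cancel-X cancel-T = subst₂ ℕ._≤_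
    (≡.trans (length-map f pairs) (length-pairs X D)) (length-pairs (X ⊙ T) (X ⊙ T))
    (Unique-⊆⇒length≤ (Unique-map f-injective (cartesianProduct⁺ (toList-Unique X) (toList-Unique D))) f-⊆)
    where
    D = quotients T
    pairs = cartesianProduct (toList X) (toList D)
    length-pairs : ∀ P Q → length (cartesianProduct (toList P) (toList Q)) ≡ ∣ P ∣ ℕ.* ∣ Q ∣
    length-pairs P Q =
      ≡.trans (length-cartesianProduct (toList P) (toList Q)) (cong₂ ℕ._*_ (length-toList P) (length-toList Q))
    denominator′ : ∀ d → ∃ λ t → d Sub.∈ D → t Sub.∈ T × (d · t) Sub.∈ T
    denominator′ d with d Sub.∈? D
    ... | yes d∈ = let t , p = ∈-comprehension⁻ (isQuotient? T) d∈ in t , λ _ → p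
    -- A dummy value outside `D`, so that the choice of a denominator is a total function.
    ... | no d∉  = d , λ d∈ → contradiction d∈ d∉
    denominator = proj₁ ∘ denominator′
    f : Fin n × Fin n → Fin n × Fin n
    f (x , d) = x · denominator d , x · (d · denominator d)
    f-⊆ : ∀ {p} → p ∈ map f pairs → p ∈ cartesianProduct (toList (X ⊙ T)) (toList (X ⊙ T))
    f-⊆ p∈ with ∈-map⁻ f p∈
    ... | (x , d) , xd∈ , refl with ∈-cartesianProduct⁻ (toList X) (toList D) xd∈
    ... | x∈ , d∈ with proj₂ (denominator′ d) (∈-toList⁻ D d∈)
    ... | t∈ , dt∈ = ∈-cartesianProduct⁺ (∈-toList⁺ (∈-⊙⁺ (∈-toList⁻ X x∈) t∈)) (∈-toList⁺ (∈-⊙⁺ (∈-toList⁻ X x∈) dt∈))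
    rotate : ∀ x d t → x · (d · t) ≡ d · (x · t)
    rotate x d t = ≡.trans (sym (assoc x d t)) (≡.trans (cong (_· t) (comm x d)) (assoc d x t))
    f-injective : ∀ {p p′} → p ∈ pairs → p′ ∈ pairs → f p ≡ f p′ → p ≡ p′
    f-injective {x , d} {x′ , d′} p∈ p′∈ eq with ∈-cartesianProduct⁻ (toList X) (toList D) p∈
    ... | x∈ , d∈ with proj₂ (denominator′ d) (∈-toList⁻ D d∈)
    ... | t∈ , _ with ·-cancellable (cancel-X (∈-toList⁻ X x∈)) (cancel-T t∈)
                        (≡.trans (sym (rotate x d (denominator d))) (≡.trans (cong proj₂ eq)
                          (≡.trans (rotate x′ d′ (denominator d′)) (cong (d′ ·_) (sym (cong proj₁ eq))))))
    ... | refl with cancel-T t∈ (cong proj₁ eq)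
    ... | refl = refl

  -- Let K = `∣ X ⊙ S ∣ / ∣ X ∣` for a minimal `X`, so K is at most `∣ S ⊙ S ∣ / ∣ S ∣`. Petridis'
  -- bound for `S` and then for `S ⊙ S` gives K² and K³ times `∣ X ∣` for `X S S` and `X S S S`.
  -- Ruzsa's inequality squares the latter, and `∣ X ∣` is at most `∣ S ∣`.
  pluennecke-ruzsa : ∀ S → 0 ℕ.< ∣ S ∣ → (∀ {s} → s Sub.∈ S → Cancellable s) →
    ∣ quotients (S ⊙ S ⊙ S) ∣ ℕ.* ∣ S ∣ ℕ.^ 5 ℕ.≤ ∣ S ⊙ S ∣ ℕ.^ 6
  pluennecke-ruzsa S 0<S cancel with minimal-exists S S 0<S
  ... | X , X⊆S , 0<X , minimal , ratio = arithmetic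
    where
    open ℕ.≤-Reasoning
    open +-*-Solver
    cancel-SS : ∀ {t} → t Sub.∈ S ⊙ S → Cancellable t
    cancel-SS = ⊙-cancellable cancel cancel
    x = ∣ X ∣
    s = ∣ S ∣
    m = ∣ S ⊙ S ∣
    a = ∣ X ⊙ S ∣
    b = ∣ X ⊙ S ⊙ S ∣
    c = ∣ X ⊙ (S ⊙ S ⊙ S) ∣
    d = ∣ quotients (S ⊙ S ⊙ S) ∣
    bx≤aa : b ℕ.* x ℕ.≤ a ℕ.* a
    bx≤aa = petridis S minimal cancel
    cx≤ab : c ℕ.* x ℕ.≤ a ℕ.* b
    cx≤ab = subst₂ (λ P Q → ∣ P ∣ ℕ.* x ℕ.≤ a ℕ.* ∣ Q ∣)
      (≡.trans (⊙-assoc X S (S ⊙ S)) (cong (X ⊙_) (⊙-comm S (S ⊙ S)))) (sym (⊙-assoc X S S))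
      (petridis (S ⊙ S) minimal cancel-SS)
    xd≤cc : x ℕ.* d ℕ.≤ c ℕ.* c
    xd≤cc = ruzsa X (S ⊙ S ⊙ S) (cancel ∘ X⊆S) (⊙-cancellable cancel-SS cancel)
    cxx≤aaa : c ℕ.* x ℕ.* x ℕ.≤ a ℕ.* (a ℕ.* a)
    cxx≤aaa = begin
      c ℕ.* x ℕ.* x     ≤⟨ ℕ.*-monoˡ-≤ x cx≤ab ⟩
      a ℕ.* b ℕ.* x     ≡⟨ ℕ.*-assoc a b x ⟩
      a ℕ.* (b ℕ.* x)   ≤⟨ ℕ.*-monoʳ-≤ a bx≤aa ⟩
      a ℕ.* (a ℕ.* a)   ∎
    x⁵d≤a⁶ : x ℕ.^ 5 ℕ.* d ℕ.≤ a ℕ.^ 6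
    x⁵d≤a⁶ = begin
      x ℕ.^ 5 ℕ.* d                           ≡⟨ solve 2 (λ x d → x :^ 5 :* d := x :* d :* x :^ 4) refl x d ⟩
      x ℕ.* d ℕ.* x ℕ.^ 4                     ≤⟨ ℕ.*-monoˡ-≤ (x ℕ.^ 4) xd≤cc ⟩
      c ℕ.* c ℕ.* x ℕ.^ 4
        ≡⟨ solve 2 (λ c x → c :* c :* x :^ 4 := (c :* x :* x) :* (c :* x :* x)) refl c x ⟩
      (c ℕ.* x ℕ.* x) ℕ.* (c ℕ.* x ℕ.* x)     ≤⟨ ℕ.*-mono-≤ cxx≤aaa cxx≤aaa ⟩
      (a ℕ.* (a ℕ.* a)) ℕ.* (a ℕ.* (a ℕ.* a)) ≡⟨ solve 1 (λ a → (a :* (a :* a)) :* (a :* (a :* a)) := a :^ 6) refl a ⟩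
      a ℕ.^ 6                                 ∎
    arithmetic : d ℕ.* s ℕ.^ 5 ℕ.≤ m ℕ.^ 6
    arithmetic = ℕ.*-cancelʳ-≤ _ _ (s ℕ.* x ℕ.^ 5) {{ℕ.>-nonZero (ℕ.*-mono-≤ 0<S (ℕ.m^n>0 x {{ℕ.>-nonZero 0<X}} 5))}} (begin
      d ℕ.* s ℕ.^ 5 ℕ.* (s ℕ.* x ℕ.^ 5)
        ≡⟨ solve 3 (λ d s x → d :* s :^ 5 :* (s :* x :^ 5) := x :^ 5 :* d :* s :^ 6) refl d s x ⟩
      x ℕ.^ 5 ℕ.* d ℕ.* s ℕ.^ 6        ≤⟨ ℕ.*-monoˡ-≤ (s ℕ.^ 6) x⁵d≤a⁶ ⟩
      a ℕ.^ 6 ℕ.* s ℕ.^ 6              ≡⟨ solve 2 (λ a s → a :^ 6 :* s :^ 6 := (a :* s) :^ 6) refl a s ⟩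
      (a ℕ.* s) ℕ.^ 6                  ≤⟨ ℕ.^-monoˡ-≤ 6 ratio ⟩
      (m ℕ.* x) ℕ.^ 6                  ≡⟨ solve 2 (λ m x → (m :* x) :^ 6 := m :^ 6 :* (x :* x :^ 5)) refl m x ⟩
      m ℕ.^ 6 ℕ.* (x ℕ.* x ℕ.^ 5)      ≤⟨ ℕ.*-monoʳ-≤ (m ℕ.^ 6) (ℕ.*-monoˡ-≤ (x ℕ.^ 5) (Sub.p⊆q⇒∣p∣≤∣q∣ X⊆S)) ⟩
      m ℕ.^ 6 ℕ.* (s ℕ.* x ℕ.^ 5)      ∎)

-- Elementary symmetric functions and the Frobenius map

module RingTheory {A : Set} {_⊕_ _⊗_ : Op₂ A} {⊖_ : Op₁ A} {𝟘 𝟙 : A}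
                  (isCommutativeRing : IsCommutativeRing _≡_ _⊕_ _⊗_ ⊖_ 𝟘 𝟙) where

  open ≡.≡-Reasoning

  R : CommutativeRing 0ℓ 0ℓ
  R = record { isCommutativeRing = isCommutativeRing }

  open CommutativeRing R public
    using (_+_; _*_; -_; 0#; 1#; semiring; commutativeSemiring; +-assoc; +-comm; *-assoc; *-comm;
           +-identityˡ; +-identityʳ; *-identityˡ; *-identityʳ; zeroˡ; zeroʳ; -‿inverseˡ; -‿inverseʳ; ring)
  open import Algebra.Properties.Semiring.Exp semiring public using (_^_; ^-assocʳ)
  open import Algebra.Properties.CommutativeSemiring.Exp commutativeSemiring public using (^-distrib-*)
  open import Algebra.Solver.Ring.NaturalCoefficients.Default commutativeSemiring public
    using (solve; _:=_; _:+_; _:*_; con)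

  open import Algebra.Properties.Semiring.Mult semiring public using (×1-homo-*) renaming (_×_ to _⋆_)

  0^ : ∀ {n} → 0 ℕ.< n → 0# ^ n ≡ 0#
  0^ {suc n} _ = zeroˡ (0# ^ n)

  1^ : ∀ n → 1# ^ n ≡ 1#
  1^ zero    = refl
  1^ (suc n) = ≡.trans (*-identityˡ _) (1^ n)

  e : ℕ → List A → A
  e zero    _        = 1#
  e (suc j) []       = 0#
  e (suc j) (x ∷ xs) = e (suc j) xs + x * e j xs

  e-resp-↭ : ∀ {xs ys} j → xs ↭ ys → e j xs ≡ e j ys
  e-resp-↭ zero          _            = refl
  e-resp-↭ (suc j)       refl         = refl
  e-resp-↭ (suc j)       (prep x p)   = cong₂ (λ u v → u + x * v) (e-resp-↭ (suc j) p) (e-resp-↭ j p)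
  e-resp-↭ {x ∷ y ∷ xs} {_ ∷ _ ∷ ys} (suc zero) (swap _ _ p) = begin
    (e 1 xs + y * 1#) + x * 1#  ≡⟨ cong (λ u → (u + y * 1#) + x * 1#) (e-resp-↭ 1 p) ⟩
    (e 1 ys + y * 1#) + x * 1#
      ≡⟨ solve 3 (λ u a b → (u :+ a) :+ b := (u :+ b) :+ a) refl (e 1 ys) (y * 1#) (x * 1#) ⟩
    (e 1 ys + x * 1#) + y * 1#  ∎
  e-resp-↭ {x ∷ y ∷ xs} {_ ∷ _ ∷ ys} (suc (suc j)) (swap _ _ p) = begin
    (e (2 ℕ.+ j) xs + y * e (suc j) xs) + x * (e (suc j) xs + y * e j xs)
      ≡⟨ cong (λ w → (w + y * e (suc j) xs) + x * (e (suc j) xs + y * e j xs)) (e-resp-↭ (2 ℕ.+ j) p) ⟩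
    (e (2 ℕ.+ j) ys + y * e (suc j) xs) + x * (e (suc j) xs + y * e j xs)
      ≡⟨ cong₂ (λ v w → (e (2 ℕ.+ j) ys + y * v) + x * (v + y * w)) (e-resp-↭ (suc j) p) (e-resp-↭ j p) ⟩
    (e (2 ℕ.+ j) ys + y * e (suc j) ys) + x * (e (suc j) ys + y * e j ys)
      ≡⟨ solve 5 (λ u v w a b → (u :+ b :* v) :+ a :* (v :+ b :* w) := (u :+ a :* v) :+ b :* (v :+ a :* w))
           refl (e (2 ℕ.+ j) ys) (e (suc j) ys) (e j ys) x y ⟩
    (e (2 ℕ.+ j) ys + x * e (suc j) ys) + y * (e (suc j) ys + x * e j ys)  ∎
  e-resp-↭ (suc j)       (trans p q)  = ≡.trans (e-resp-↭ (suc j) p) (e-resp-↭ (suc j) q)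

  e-scale : ∀ c j xs → e j (map (c *_) xs) ≡ c ^ j * e j xs
  e-scale c zero    xs       = sym (*-identityˡ 1#)
  e-scale c (suc j) []       = sym (zeroʳ (c ^ suc j))
  e-scale c (suc j) (x ∷ xs) = begin
    e (suc j) (map (c *_) xs) + (c * x) * e j (map (c *_) xs)
      ≡⟨ cong₂ (λ u v → u + (c * x) * v) (e-scale c (suc j) xs) (e-scale c j xs) ⟩
    c * c ^ j * e (suc j) xs + (c * x) * (c ^ j * e j xs)
      ≡⟨ solve 5 (λ c x d u v → c :* d :* u :+ (c :* x) :* (d :* v) := c :* d :* (u :+ x :* v))
           refl c x (c ^ j) (e (suc j) xs) (e j xs) ⟩
    c * c ^ j * (e (suc j) xs + x * e j xs)  ∎

  e-length< : ∀ {j} xs → length xs ℕ.< j → e j xs ≡ 0#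
  e-length< {suc j} []       _         = refl
  e-length< {suc j} (x ∷ xs) (s≤s l<j) = begin
    e (suc j) xs + x * e j xs  ≡⟨ cong₂ (λ u v → u + x * v) (e-length< xs (ℕ.m<n⇒m<1+n l<j)) (e-length< xs l<j) ⟩
    0# + x * 0#                ≡⟨ ≡.trans (+-identityˡ _) (zeroʳ x) ⟩
    0#                         ∎

  -- The degree is defined through difference quotients: h r is the quotient of g by (X - r).
  Degree≤ : ℕ → (A → A) → Set
  Degree≤ zero    g = ∀ x y → g x ≡ g y
  Degree≤ (suc d) g = ∀ r → ∃ λ h → Degree≤ d h × (∀ t → g (t + r) ≡ g r + t * h (t + r))

  Degree≤-const : ∀ d c → Degree≤ d (const c)
  Degree≤-const zero    c = λ _ _ → refl
  Degree≤-const (suc d) c = λ r → const 0# , Degree≤-const d 0# ,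
    λ t → sym (≡.trans (cong (c +_) (zeroʳ t)) (+-identityʳ c))

  Degree≤-+ : ∀ d {f g} → Degree≤ d f → Degree≤ d g → Degree≤ d (λ y → f y + g y)
  Degree≤-+ zero    F G = λ x y → cong₂ _+_ (F x y) (G x y)
  Degree≤-+ (suc d) {f} {g} F G r with F r | G r
  ... | h , H , f≡ | k , K , g≡ = _ , Degree≤-+ d H K , λ t → begin
    f (t + r) + g (t + r)  ≡⟨ cong₂ _+_ (f≡ t) (g≡ t) ⟩
    (f r + t * h (t + r)) + (g r + t * k (t + r))
      ≡⟨ solve 5 (λ f g t h k → (f :+ t :* h) :+ (g :+ t :* k) := (f :+ g) :+ t :* (h :+ k))
           refl (f r) (g r) t (h (t + r)) (k (t + r)) ⟩
    (f r + g r) + t * (h (t + r) + k (t + r))  ∎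

  Degree≤-linear* : ∀ d a b {g} → Degree≤ d g → Degree≤ (suc d) (λ y → (a + y * b) * g y)
  Degree≤-linear* zero a b {g} G r = const (b * g r) , Degree≤-const 0 _ , λ t → begin
    (a + (t + r) * b) * g (t + r)  ≡⟨ cong ((a + (t + r) * b) *_) (G (t + r) r) ⟩
    (a + (t + r) * b) * g r
      ≡⟨ solve 5 (λ a b t r g → (a :+ (t :+ r) :* b) :* g := (a :+ r :* b) :* g :+ t :* (b :* g))
           refl a b t r (g r) ⟩
    (a + r * b) * g r + t * (b * g r)  ∎
  Degree≤-linear* (suc d) a b {g} G r with G r
  ... | h , H , g≡ = _ , Degree≤-+ (suc d) (Degree≤-const (suc d) (b * g r)) (Degree≤-linear* d a b H) , λ t → begin
    (a + (t + r) * b) * g (t + r)  ≡⟨ cong ((a + (t + r) * b) *_) (g≡ t) ⟩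
    (a + (t + r) * b) * (g r + t * h (t + r))
      ≡⟨ solve 6 (λ a b t r g h → (a :+ (t :+ r) :* b) :* (g :+ t :* h)
                    := (a :+ r :* b) :* g :+ t :* (b :* g :+ (a :+ (t :+ r) :* b) :* h))
           refl a b t r (g r) (h (t + r)) ⟩
    (a + r * b) * g r + t * (b * g r + (a + (t + r) * b) * h (t + r))  ∎

  Degree≤-resp-≗ : ∀ d {f g} → f ≗ g → Degree≤ d f → Degree≤ d g
  Degree≤-resp-≗ zero    f≗g F x y = ≡.trans (sym (f≗g x)) (≡.trans (F x y) (f≗g y))
  Degree≤-resp-≗ (suc d) f≗g F r with F r
  ... | h , H , f≡ = h , H , λ t → ≡.trans (sym (f≗g _)) (≡.trans (f≡ t) (cong (_+ t * h (t + r)) (f≗g r)))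

  Degree≤-^ : ∀ d → Degree≤ d (_^ d)
  Degree≤-^ zero    = Degree≤-const 0 1#
  Degree≤-^ (suc d) = Degree≤-resp-≗ (suc d)
    (λ y → cong (_* y ^ d) (≡.trans (+-identityˡ _) (*-identityʳ y)))
    (Degree≤-linear* d 0# 1# (Degree≤-^ d))

  -- Every term of `e j` is a product of `j` factors that are linear in `y`.
  Degree≤-e : ∀ j ps → Degree≤ j (λ y → e j (map (λ p → proj₁ p + y * proj₂ p) ps))
  Degree≤-e zero    ps       = Degree≤-const 0 1#
  Degree≤-e (suc j) []       = Degree≤-const (suc j) 0#
  Degree≤-e (suc j) (p ∷ ps) = Degree≤-+ (suc j) (Degree≤-e (suc j) ps)
    (Degree≤-linear* j (proj₁ p) (proj₂ p) (Degree≤-e j ps))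

  -- Binomial expansion and prime characteristic

  fromℕ : ℕ → A
  fromℕ n = n ⋆ 1#

  sum : ℕ → (ℕ → A) → A
  sum zero    f = 0#
  sum (suc n) f = f 0 + sum n (f ∘ suc)

  sum-cong : ∀ n {f g} → f ≗ g → sum n f ≡ sum n g
  sum-cong zero    f≗g = refl
  sum-cong (suc n) f≗g = cong₂ _+_ (f≗g 0) (sum-cong n (f≗g ∘ suc))

  sum-last : ∀ n f → sum (suc n) f ≡ sum n f + f n
  sum-last zero    f = +-comm (f 0) 0#
  sum-last (suc n) f = ≡.trans (cong (f 0 +_) (sum-last n (f ∘ suc))) (sym (+-assoc _ _ _))

  sum-+* : ∀ a n f g → sum n (λ i → f i + a * g i) ≡ sum n f + a * sum n g
  sum-+* a zero    f g = sym (≡.trans (+-identityˡ _) (zeroʳ a))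
  sum-+* a (suc n) f g = begin
    (f 0 + a * g 0) + sum n (λ i → f (suc i) + a * g (suc i))
      ≡⟨ cong ((f 0 + a * g 0) +_) (sum-+* a n (f ∘ suc) (g ∘ suc)) ⟩
    (f 0 + a * g 0) + (sum n (f ∘ suc) + a * sum n (g ∘ suc))
      ≡⟨ solve 5 (λ f a g u v → (f :+ a :* g) :+ (u :+ a :* v) := (f :+ u) :+ a :* (g :+ v))
           refl (f 0) a (g 0) (sum n (f ∘ suc)) (sum n (g ∘ suc)) ⟩
    (f 0 + sum n (f ∘ suc)) + a * (g 0 + sum n (g ∘ suc))  ∎

  sum-zero : ∀ n f → (∀ i → i ℕ.< n → f i ≡ 0#) → sum n f ≡ 0#
  sum-zero zero    f f≡0 = refl
  sum-zero (suc n) f f≡0 =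
    ≡.trans (cong₂ _+_ (f≡0 0 (s≤s z≤n)) (sum-zero n (f ∘ suc) (λ i i<n → f≡0 (suc i) (s≤s i<n))))
                                   (+-identityˡ 0#)

  -- coefficient a r i is the coefficient of X ^ i in (X + a) ^ r.
  coefficient : A → ℕ → ℕ → A
  coefficient a zero    zero    = 1#
  coefficient a zero    (suc i) = 0#
  coefficient a (suc r) zero    = a * coefficient a r zero
  coefficient a (suc r) (suc i) = coefficient a r i + a * coefficient a r (suc i)

  coefficient-zero : ∀ a r → coefficient a r 0 ≡ a ^ r
  coefficient-zero a zero    = refl
  coefficient-zero a (suc r) = cong (a *_) (coefficient-zero a r)

  coefficient-> : ∀ a {r i} → r ℕ.< i → coefficient a r i ≡ 0#
  coefficient-> a {zero}  {suc i} _         = refl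
  coefficient-> a {suc r} {suc i} (s≤s r<i) = begin
    coefficient a r i + a * coefficient a r (suc i)
      ≡⟨ cong₂ (λ u v → u + a * v) (coefficient-> a r<i) (coefficient-> a (ℕ.m<n⇒m<1+n r<i)) ⟩
    0# + a * 0#  ≡⟨ ≡.trans (+-identityˡ _) (zeroʳ a) ⟩
    0#           ∎

  coefficient-diagonal : ∀ a r → coefficient a r r ≡ 1#
  coefficient-diagonal a zero    = refl
  coefficient-diagonal a (suc r) = begin
    coefficient a r r + a * coefficient a r (suc r)
      ≡⟨ cong₂ (λ u v → u + a * v) (coefficient-diagonal a r) (coefficient-> a (ℕ.n<1+n r)) ⟩
    1# + a * 0#  ≡⟨ ≡.trans (cong (1# +_) (zeroʳ a)) (+-identityʳ 1#) ⟩
    1#           ∎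

  -- Differentiating (X + a) ^ (1 + r).
  coefficient-derivative : ∀ a r i → fromℕ (suc i) * coefficient a (suc r) (suc i) ≡ fromℕ (suc r) * coefficient a r i
  coefficient-derivative a zero    zero    =
    solve 2 (λ a o → (o :+ con 0) :* (o :+ a :* con 0) := (o :+ con 0) :* o) refl a 1#
  coefficient-derivative a zero    (suc i) =
    solve 3 (λ a n o → n :* (con 0 :+ a :* con 0) := (o :+ con 0) :* con 0) refl a (fromℕ (2 ℕ.+ i)) 1#
  coefficient-derivative a (suc r) zero    = begin
    (1# + 0#) * (a * c₀ + a * c₁)
      ≡⟨ solve 3 (λ a c d → (con 1 :+ con 0) :* (a :* c :+ a :* d) := a :* c :+ a :* ((con 1 :+ con 0) :* d)) refl a c₀ c₁ ⟩
    a * c₀ + a * ((1# + 0#) * c₁)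
      ≡⟨ cong (λ u → a * c₀ + a * u) (coefficient-derivative a r 0) ⟩
    a * c₀ + a * (fromℕ (suc r) * c₀)
      ≡⟨ solve 3 (λ a c n → a :* c :+ a :* (n :* c) := (con 1 :+ n) :* (a :* c)) refl a c₀ (fromℕ (suc r)) ⟩
    (1# + fromℕ (suc r)) * (a * c₀)  ∎
    where
    c₀ = coefficient a r 0
    c₁ = coefficient a (suc r) 1
  coefficient-derivative a (suc r) (suc i) = begin
    (1# + fromℕ (suc i)) * (c₁ + a * c₂)
      ≡⟨ solve 4 (λ n c a d → (con 1 :+ n) :* (c :+ a :* d) := c :+ (n :* c :+ a :* ((con 1 :+ n) :* d)))
           refl (fromℕ (suc i)) c₁ a c₂ ⟩
    c₁ + (fromℕ (suc i) * c₁ + a * (fromℕ (2 ℕ.+ i) * c₂))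
      ≡⟨ cong₂ (λ u v → c₁ + (u + a * v)) (coefficient-derivative a r i) (coefficient-derivative a r (suc i)) ⟩
    c₁ + (fromℕ (suc r) * d + a * (fromℕ (suc r) * d′))
      ≡⟨ solve 4 (λ n c a d → (c :+ a :* d) :+ (n :* c :+ a :* (n :* d)) := (con 1 :+ n) :* (c :+ a :* d))
           refl (fromℕ (suc r)) d a d′ ⟩
    (1# + fromℕ (suc r)) * c₁  ∎
    where
    c₁ = coefficient a (suc r) (suc i)
    c₂ = coefficient a (suc r) (2 ℕ.+ i)
    d  = coefficient a r i
    d′ = coefficient a r (suc i)

  -- u r is the image of u 0 under (σ ^ m + a) ^ r, where σ is the shift of sequences.
  IsShiftPower : ℕ → A → (ℕ → ℕ → A) → Set
  IsShiftPower m a u = ∀ r x → u (suc r) x ≡ u r (m ℕ.+ x) + a * u r x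

  -- The binomial theorem for the commuting operators `σ ^ m` and multiplication by `a`. Stated for
  -- sequences, it serves both the Frobenius map and the effect on `e` of repeating an entry.
  shiftPower-expand : ∀ {m a u} → IsShiftPower m a u →
    ∀ r x → u r x ≡ sum (suc r) (λ i → coefficient a r i * u 0 (i ℕ.* m ℕ.+ x))
  shiftPower-expand {m} {a} {u} step zero    x =
    solve 1 (λ v → v := con 1 :* v :+ con 0) refl (u 0 x)
  shiftPower-expand {m} {a} {u} step (suc r) x = begin
    u (suc r) x              ≡⟨ step r x ⟩
    u r (m ℕ.+ x) + a * u r x
      ≡⟨ cong₂ (λ v w → v + a * w) (shiftPower-expand step r (m ℕ.+ x)) (shiftPower-expand step r x) ⟩
    sum (suc r) (λ i → c i * u 0 (i ℕ.* m ℕ.+ (m ℕ.+ x))) + a * sum (suc r) G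
      ≡⟨ cong₂ (λ v w → v + a * w) (sum-cong (suc r) shifted) padded ⟩
    sum (suc r) F + a * sum (2 ℕ.+ r) G
      ≡⟨ solve 5 (λ s a c v t → s :+ a :* (c :* v :+ t) := (a :* c) :* v :+ (s :+ a :* t))
           refl (sum (suc r) F) a (c 0) (u 0 x) (sum (suc r) (G ∘ suc)) ⟩
    (a * c 0) * u 0 x + (sum (suc r) F + a * sum (suc r) (G ∘ suc))
      ≡⟨ cong ((a * c 0) * u 0 x +_) (sym (sum-+* a (suc r) F (G ∘ suc))) ⟩
    (a * c 0) * u 0 x + sum (suc r) (λ i → F i + a * G (suc i))
      ≡⟨ cong ((a * c 0) * u 0 x +_) (sum-cong (suc r) (λ i →
           solve 4 (λ c a d v → c :* v :+ a :* (d :* v) := (c :+ a :* d) :* v) refl (c i) a (c (suc i)) (u 0 (suc i ℕ.* m ℕ.+ x)))) ⟩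
    sum (2 ℕ.+ r) (λ i → coefficient a (suc r) i * u 0 (i ℕ.* m ℕ.+ x))  ∎
    where
    c = coefficient a r
    F G : ℕ → A
    F i = c i * u 0 (suc i ℕ.* m ℕ.+ x)
    G i = c i * u 0 (i ℕ.* m ℕ.+ x)
    shifted : ∀ i → c i * u 0 (i ℕ.* m ℕ.+ (m ℕ.+ x)) ≡ F i
    shifted i =
      cong (λ k → c i * u 0 k) (≡.trans (sym (ℕ.+-assoc (i ℕ.* m) m x)) (cong (ℕ._+ x) (ℕ.+-comm (i ℕ.* m) m)))
    -- A term beyond the diagonal has coefficient zero. With it, splitting off the first term leaves
    -- two sums of equal length.
    padded : sum (suc r) G ≡ sum (2 ℕ.+ r) G
    padded = sym (begin
      sum (2 ℕ.+ r) G            ≡⟨ sum-last (suc r) G ⟩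
      sum (suc r) G + G (suc r)
        ≡⟨ cong (λ v → sum (suc r) G + v * u 0 (suc r ℕ.* m ℕ.+ x)) (coefficient-> a (ℕ.n<1+n r)) ⟩
      sum (suc r) G + 0# * u 0 (suc r ℕ.* m ℕ.+ x)  ≡⟨ cong (sum (suc r) G +_) (zeroˡ _) ⟩
      sum (suc r) G + 0#         ≡⟨ +-identityʳ _ ⟩
      sum (suc r) G              ∎)

  module PrimeCharacteristic {p-1 : ℕ} (prime : Prime (suc p-1)) (p≡0 : fromℕ (suc p-1) ≡ 0#) where

    private
      p : ℕ
      p = suc p-1

    fromℕ-*p : ∀ n → fromℕ (n ℕ.* p) ≡ 0#
    fromℕ-*p n = ≡.trans (×1-homo-* n p) (≡.trans (cong (fromℕ n *_) p≡0) (zeroʳ _))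

    -- A Bézout relation makes some multiple of `suc i` equal to 1 or to -1 modulo `p`, which serves
    -- as an inverse without a field structure.
    fromℕ-*-cancel : ∀ {i} z → suc i ℕ.< p → fromℕ (suc i) * z ≡ 0# → z ≡ 0#
    fromℕ-*-cancel {i} z i<p iz≡0 with coprime-Bézout (prime⇒coprime prime i<p)
    ... | Bézout.+- x y eq = begin
      z                                   ≡⟨ solve 1 (λ z → z := z :+ con 0) refl z ⟩
      z + 0#                              ≡⟨ cong (z +_) (sym multiple≡0) ⟩
      z + fromℕ (y ℕ.* suc i) * z
        ≡⟨ solve 2 (λ n z → z :+ n :* z := (con 1 :+ n) :* z) refl (fromℕ (y ℕ.* suc i)) z ⟩
      fromℕ (1 ℕ.+ y ℕ.* suc i) * z       ≡⟨ cong (λ n → fromℕ n * z) eq ⟩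
      fromℕ (x ℕ.* p) * z                 ≡⟨ cong (_* z) (fromℕ-*p x) ⟩
      0# * z                              ≡⟨ zeroˡ z ⟩
      0#                                  ∎
      where
      multiple≡0 : fromℕ (y ℕ.* suc i) * z ≡ 0#
      multiple≡0 = begin
        fromℕ (y ℕ.* suc i) * z         ≡⟨ cong (_* z) (×1-homo-* y (suc i)) ⟩
        fromℕ y * fromℕ (suc i) * z     ≡⟨ *-assoc _ _ z ⟩
        fromℕ y * (fromℕ (suc i) * z)   ≡⟨ cong (fromℕ y *_) iz≡0 ⟩
        fromℕ y * 0#                    ≡⟨ zeroʳ _ ⟩
        0#                              ∎
    ... | Bézout.-+ x y eq = begin
      z                                   ≡⟨ solve 1 (λ z → z := (con 1 :+ con 0) :* z) refl z ⟩
      (1# + 0#) * z                       ≡⟨ cong (λ u → (1# + u) * z) (sym (fromℕ-*p x)) ⟩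
      fromℕ (1 ℕ.+ x ℕ.* p) * z           ≡⟨ cong (λ n → fromℕ n * z) eq ⟩
      fromℕ (y ℕ.* suc i) * z             ≡⟨ cong (_* z) (×1-homo-* y (suc i)) ⟩
      fromℕ y * fromℕ (suc i) * z         ≡⟨ *-assoc _ _ z ⟩
      fromℕ y * (fromℕ (suc i) * z)       ≡⟨ cong (fromℕ y *_) iz≡0 ⟩
      fromℕ y * 0#                        ≡⟨ zeroʳ _ ⟩
      0#                                  ∎

    -- The derivative of (X + a) ^ p is zero, and the factors `suc i` below `p` that it introduces
    -- can be cancelled.
    coefficient-middle : ∀ a {i} → suc i ℕ.< p → coefficient a p (suc i) ≡ 0#
    coefficient-middle a {i} i<p = fromℕ-*-cancel _ i<p (begin
      fromℕ (suc i) * coefficient a p (suc i)  ≡⟨ coefficient-derivative a p-1 i ⟩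
      fromℕ p * coefficient a p-1 i            ≡⟨ cong (_* coefficient a p-1 i) p≡0 ⟩
      0# * coefficient a p-1 i                 ≡⟨ zeroˡ _ ⟩
      0#                                       ∎)

    shiftPower-prime : ∀ {m a u} → IsShiftPower m a u →
      ∀ x → u p x ≡ u 0 (p ℕ.* m ℕ.+ x) + a ^ p * u 0 x
    shiftPower-prime {m} {a} {u} step x = begin
      u p x                                ≡⟨ shiftPower-expand step p x ⟩
      G 0 + sum p (G ∘ suc)                ≡⟨ cong (G 0 +_) (sum-last p-1 (G ∘ suc)) ⟩
      G 0 + (sum p-1 (G ∘ suc) + G p)      ≡⟨ cong (λ v → G 0 + (v + G p)) (sum-zero p-1 (G ∘ suc) middle) ⟩
      G 0 + (0# + G p)
        ≡⟨ cong₂ (λ v w → v * u 0 x + (0# + w * u 0 (p ℕ.* m ℕ.+ x))) (coefficient-zero a p) (coefficient-diagonal a p) ⟩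
      a ^ p * u 0 x + (0# + 1# * u 0 (p ℕ.* m ℕ.+ x))
        ≡⟨ solve 2 (λ v w → v :+ (con 0 :+ con 1 :* w) := w :+ v) refl (a ^ p * u 0 x) _ ⟩
      u 0 (p ℕ.* m ℕ.+ x) + a ^ p * u 0 x  ∎
      where
      G : ℕ → A
      G i = coefficient a p i * u 0 (i ℕ.* m ℕ.+ x)
      middle : ∀ i → i ℕ.< p-1 → G (suc i) ≡ 0#
      middle i i<p-1 = ≡.trans (cong (_* u 0 (suc i ℕ.* m ℕ.+ x)) (coefficient-middle a (s≤s i<p-1))) (zeroˡ _)

    -- The rows at multiples of `p ^ k` again form a shift power, for the shift by `p ^ k` and the
    -- factor `a ^ (p ^ k)`, to which the prime case applies. The shift `m` in `IsShiftPower` is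
    -- general for the sake of this iteration.
    shiftPower-primePower : ∀ k {a u} → IsShiftPower 1 a u →
      ∀ x → u (p ℕ.^ k) x ≡ u 0 (p ℕ.^ k ℕ.+ x) + a ^ (p ℕ.^ k) * u 0 x
    shiftPower-primePower zero    {a} {u} step x = ≡.trans (step 0 x)
      (cong (λ b → u 0 (suc x) + b * u 0 x) (sym (*-identityʳ a)))
    shiftPower-primePower (suc k) {a} {u} step x = ≡.trans (shiftPower-prime {p ℕ.^ k} {a ^ (p ℕ.^ k)} {v} v-step x)
      (cong (λ b → u 0 (p ℕ.^ suc k ℕ.+ x) + b * u 0 x)
        (≡.trans (^-assocʳ a (p ℕ.^ k) p) (cong (a ^_) (ℕ.*-comm (p ℕ.^ k) p))))
      where
      v : ℕ → ℕ → A
      v r = u (r ℕ.* p ℕ.^ k)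
      v-step : IsShiftPower (p ℕ.^ k) (a ^ (p ℕ.^ k)) v
      -- The induction hypothesis, applied to the array that starts at row `r * p ^ k`.
      v-step r y = shiftPower-primePower k {a} {λ s → u (s ℕ.+ r ℕ.* p ℕ.^ k)} (λ s → step (s ℕ.+ r ℕ.* p ℕ.^ k)) y

    -- Multiplication by `x + y` is the sum of raising the exponent of `y` and multiplying by `x`,
    -- so the array `(x + y) ^ r * y ^ j` is a shift power.
    frobenius : ∀ k x y → (x + y) ^ (p ℕ.^ k) ≡ x ^ (p ℕ.^ k) + y ^ (p ℕ.^ k)
    frobenius k x y = begin
      (x + y) ^ q                      ≡⟨ sym (*-identityʳ _) ⟩
      (x + y) ^ q * y ^ 0              ≡⟨ shiftPower-primePower k {x} {λ r j → (x + y) ^ r * y ^ j} step 0 ⟩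
      1# * y ^ (q ℕ.+ 0) + x ^ q * (1# * 1#)
        ≡⟨ cong (λ j → 1# * y ^ j + x ^ q * (1# * 1#)) (ℕ.+-identityʳ q) ⟩
      1# * y ^ q + x ^ q * (1# * 1#)
        ≡⟨ solve 2 (λ u v → con 1 :* v :+ u :* (con 1 :* con 1) := u :+ v) refl (x ^ q) (y ^ q) ⟩
      x ^ q + y ^ q                    ∎
      where
      q = p ℕ.^ k
      step : IsShiftPower 1 x (λ r j → (x + y) ^ r * y ^ j)
      step r j =
        solve 4 (λ x y u v → (x :+ y) :* u :* v := u :* (y :* v) :+ x :* (u :* v)) refl x y ((x + y) ^ r) (y ^ j)

    -- In generating functions: (1 + a X) ^ q = 1 + a ^ q X ^ q for q = `p ^ k`. Reading `e` at
    -- index `r + j` after `r` copies of `a` turns its recursion into a shift power.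
    e-replicate : ∀ k a xs j →
      e (p ℕ.^ k ℕ.+ j) (replicate (p ℕ.^ k) a ++ xs) ≡ e (p ℕ.^ k ℕ.+ j) xs + a ^ (p ℕ.^ k) * e j xs
    e-replicate k a xs = shiftPower-primePower k {a} {λ r j → e (r ℕ.+ j) (replicate r a ++ xs)} step
      where
      step : IsShiftPower 1 a (λ r j → e (r ℕ.+ j) (replicate r a ++ xs))
      step r j = cong (λ i → e i (replicate r a ++ xs) + a * e (r ℕ.+ j) (replicate r a ++ xs)) (sym (ℕ.+-suc r j))

    -- The product of the (1 + x X) ^ q is the product of the 1 + x ^ q X ^ q. Its coefficient at X
    -- ^ (i q) is `e i` of the q-th powers, which is the q-th power of `e i xs`.
    e-copies : ∀ k i xs → e (i ℕ.* p ℕ.^ k) (concatMap (replicate (p ℕ.^ k)) xs) ≡ e i xs ^ (p ℕ.^ k)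
    e-copies k zero    xs       = sym (1^ (p ℕ.^ k))
    e-copies k (suc i) []       = ≡.trans (e-length< [] (ℕ.<-≤-trans (ℕ.m^n>0 p k) (ℕ.m≤m+n (p ℕ.^ k) _)))
                                          (sym (0^ (ℕ.m^n>0 p k)))
    e-copies k (suc i) (x ∷ xs) = begin
      e (q ℕ.+ i ℕ.* q) (replicate q x ++ concatMap (replicate q) xs)
        ≡⟨ e-replicate k x (concatMap (replicate q) xs) (i ℕ.* q) ⟩
      e (suc i ℕ.* q) (concatMap (replicate q) xs) + x ^ q * e (i ℕ.* q) (concatMap (replicate q) xs)
        ≡⟨ cong₂ (λ u v → u + x ^ q * v) (e-copies k (suc i) xs) (e-copies k i xs) ⟩
      e (suc i) xs ^ q + x ^ q * e i xs ^ q    ≡⟨ cong (e (suc i) xs ^ q +_) (sym (^-distrib-* x (e i xs) q)) ⟩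
      e (suc i) xs ^ q + (x * e i xs) ^ q      ≡⟨ sym (frobenius k _ _) ⟩
      (e (suc i) xs + x * e i xs) ^ q          ∎
      where q = p ℕ.^ k

-- Fields

module FieldTheory {A : Set} {_⊕_ _⊗_ : Op₂ A} {⊖_ : Op₁ A} {𝟘 𝟙 : A}
                   (isCommutativeRing : IsCommutativeRing _≡_ _⊕_ _⊗_ ⊖_ 𝟘 𝟙)
                   (_≟_ : DecidableEquality A) (0≢1 : 𝟘 ≢ 𝟙)
                   (_⁻¹ : Op₁ A) (0⁻¹≡0 : 𝟘 ⁻¹ ≡ 𝟘) (inverseʳ : ∀ {x} → x ≢ 𝟘 → x ⊗ (x ⁻¹) ≡ 𝟙) where

  open ≡.≡-Reasoning
  open RingTheory isCommutativeRing public
  open import Algebra.Properties.Ring ring public using (+-cancelˡ; +-cancelʳ; x∙y⁻¹≈ε⇒x≈y)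

  *-cancelˡ : ∀ {x y z} → x ≢ 0# → x * y ≡ x * z → y ≡ z
  *-cancelˡ {x} {y} {z} x≢0 xy≡xz = begin
    y                ≡⟨ unit y ⟩
    x ⁻¹ * (x * y)   ≡⟨ cong (x ⁻¹ *_) xy≡xz ⟩
    x ⁻¹ * (x * z)   ≡⟨ unit z ⟨
    z                ∎
    where
    unit : ∀ w → w ≡ x ⁻¹ * (x * w)
    unit w = begin
      w                ≡⟨ *-identityˡ w ⟨
      1# * w           ≡⟨ cong (_* w) (≡.trans (sym (inverseʳ x≢0)) (*-comm x _)) ⟩
      x ⁻¹ * x * w     ≡⟨ *-assoc _ x w ⟩
      x ⁻¹ * (x * w)   ∎

  x*y≡0⇒y≡0 : ∀ {x y} → x ≢ 0# → x * y ≡ 0# → y ≡ 0#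
  x*y≡0⇒y≡0 {x} x≢0 xy≡0 = *-cancelˡ x≢0 (≡.trans xy≡0 (sym (zeroʳ x)))

  *≢0 : ∀ {x y} → x ≢ 0# → y ≢ 0# → x * y ≢ 0#
  *≢0 x≢0 y≢0 xy≡0 = y≢0 (x*y≡0⇒y≡0 x≢0 xy≡0)

  ^≢0 : ∀ {x} n → x ≢ 0# → x ^ n ≢ 0#
  ^≢0 zero    x≢0 = 0≢1 ∘ sym
  ^≢0 (suc n) x≢0 = *≢0 x≢0 (^≢0 n x≢0)

  ^≡0⇒≡0 : ∀ {x} n → x ^ n ≡ 0# → x ≡ 0#
  ^≡0⇒≡0 {x} n xⁿ≡0 with x ≟ 0#
  ... | yes x≡0 = x≡0
  ... | no  x≢0 = contradiction xⁿ≡0 (^≢0 n x≢0)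

  ⁻¹-≢0 : ∀ {x} → x ≢ 0# → x ⁻¹ ≢ 0#
  ⁻¹-≢0 {x} x≢0 x⁻¹≡0 = 0≢1 (≡.trans (sym (zeroʳ x)) (≡.trans (cong (x *_) (sym x⁻¹≡0)) (inverseʳ x≢0)))

  ⁻¹-involutive : ∀ x → (x ⁻¹) ⁻¹ ≡ x
  ⁻¹-involutive x with x ≟ 0#
  ... | yes refl = ≡.trans (cong _⁻¹ 0⁻¹≡0) 0⁻¹≡0
  ... | no  x≢0  = *-cancelˡ (⁻¹-≢0 x≢0) (≡.trans (inverseʳ (⁻¹-≢0 x≢0)) (≡.trans (sym (inverseʳ x≢0)) (*-comm x _)))

  ⁻¹-injective : ∀ {x y} → x ⁻¹ ≡ y ⁻¹ → x ≡ y
  ⁻¹-injective {x} {y} eq = ≡.trans (sym (⁻¹-involutive x)) (≡.trans (cong _⁻¹ eq) (⁻¹-involutive y))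

  x-y≡0⇒x≡y : ∀ {x y} → x + - y ≡ 0# → x ≡ y
  x-y≡0⇒x≡y {x} {y} = x∙y⁻¹≈ε⇒x≈y x y

  [x-y]+y : ∀ x y → (x + - y) + y ≡ x
  [x-y]+y x y = ≡.trans (+-assoc x (- y) y) (≡.trans (cong (x +_) (-‿inverseˡ y)) (+-identityʳ x))

  -- At a zero `r` the constant term drops out and `g z` becomes `(z - r) * h z`. The remaining
  -- zeros of `g` pass to `h`, whose degree bound is one less.
  roots : ∀ d {g} xs → Degree≤ d g → Unique xs → d ℕ.< length xs → (∀ {x} → x ∈ xs → g x ≡ 0#) → ∀ y → g y ≡ 0#
  roots zero        (x ∷ xs) G xs!            _         g≡0 y = ≡.trans (G y x) (g≡0 (here refl))
  roots (suc d) {g} (r ∷ xs) G r∷xs!@(_ ∷ xs!) (s≤s d<n) g≡0 y with G r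
  ... | h , H , g≡ = begin
    g y                          ≡⟨ expand y ⟩
    (y + - r) * h y              ≡⟨ cong ((y + - r) *_) (roots d xs H xs! d<n h≡0 y) ⟩
    (y + - r) * 0#               ≡⟨ zeroʳ _ ⟩
    0#                           ∎
    where
    expand : ∀ z → g z ≡ (z + - r) * h z
    expand z = begin
      g z                                       ≡⟨ cong g ([x-y]+y z r) ⟨
      g ((z + - r) + r)                         ≡⟨ g≡ (z + - r) ⟩
      g r + (z + - r) * h ((z + - r) + r)       ≡⟨ cong₂ (λ u v → u + (z + - r) * h v) (g≡0 (here refl)) ([x-y]+y z r) ⟩
      0# + (z + - r) * h z                      ≡⟨ +-identityˡ _ ⟩
      (z + - r) * h z                           ∎
    h≡0 : ∀ {x} → x ∈ xs → h x ≡ 0#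
    h≡0 {x} x∈xs = x*y≡0⇒y≡0 (λ x-r≡0 → Unique[x∷xs]⇒x∉xs r∷xs! (subst (_∈ xs) (x-y≡0⇒x≡y x-r≡0) x∈xs))
                            (≡.trans (sym (expand x)) (g≡0 (there x∈xs)))

  -- Otherwise X ^ n - 1 would have more than `n` zeros and would vanish at 0 as well.
  ^≡1-length≤ : ∀ n {xs} → 0 ℕ.< n → Unique xs → (∀ {x} → x ∈ xs → x ^ n ≡ 1#) → length xs ℕ.≤ n
  ^≡1-length≤ n@(suc m) {xs} _ xs! xⁿ≡1 = ℕ.≮⇒≥ λ n<len → 0≢1 (begin
    0#                    ≡⟨ zeroˡ _ ⟨
    0# ^ n                ≡⟨ x-y≡0⇒x≡y (roots n xs degree xs! n<len root 0#) ⟩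
    1#                    ∎)
    where
    degree : Degree≤ n (λ x → x ^ n + - 1#)
    degree = Degree≤-+ n (Degree≤-^ n) (Degree≤-const n (- 1#))
    root : ∀ {x} → x ∈ xs → x ^ n + - 1# ≡ 0#
    root x∈xs = ≡.trans (cong (_+ - 1#) (xⁿ≡1 x∈xs)) (-‿inverseʳ 1#)

  e-length-∷ : ∀ x xs → e (length (x ∷ xs)) (x ∷ xs) ≡ x * e (length xs) xs
  e-length-∷ x xs = ≡.trans (cong (_+ x * e (length xs) xs) (e-length< xs (ℕ.n<1+n _))) (+-identityˡ _)

  e-length≢0 : ∀ xs → (∀ {x} → x ∈ xs → x ≢ 0#) → e (length xs) xs ≢ 0#
  e-length≢0 []       _   = 0≢1 ∘ sym
  e-length≢0 (x ∷ xs) ≢0s = subst (_≢ 0#) (sym (e-length-∷ x xs)) (*≢0 (≢0s (here refl)) (e-length≢0 xs (≢0s ∘ there)))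

  -- Fermat's argument: multiplication by `c` permutes `xs` and multiplies the product of its
  -- entries by `c ^ length xs`.
  *-closed⇒^≡1 : ∀ {xs} → Unique xs → (∀ {x} → x ∈ xs → x ≢ 0#) → ∀ {c} → c ≢ 0# →
    (∀ {x} → x ∈ xs → c * x ∈ xs) → c ^ length xs ≡ 1#
  *-closed⇒^≡1 {xs} xs! ≢0s {c} c≢0 closed = *-cancelˡ (e-length≢0 xs ≢0s) (begin
    P * c ^ length xs          ≡⟨ *-comm P _ ⟩
    c ^ length xs * P          ≡⟨ e-scale c (length xs) xs ⟨
    e (length xs) (map (c *_) xs)  ≡⟨ e-resp-↭ (length xs) perm ⟩
    P                          ≡⟨ *-identityʳ P ⟨
    P * 1#                     ∎)
    where
    P = e (length xs) xs
    perm : map (c *_) xs ↭ xs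
    perm = Unique-⊆⇒↭ (Unique-map (λ _ _ → *-cancelˡ c≢0) xs!)
      (λ z∈ → let x , x∈xs , z≡ = ∈-map⁻ (c *_) z∈ in subst (_∈ xs) (sym z≡) (closed x∈xs))
      (ℕ.≤-reflexive (sym (length-map (c *_) xs)))

  -- The product of the 1 + X / x times the product of the x is the product of the x + X, and this
  -- has the coefficients of the product of the 1 + x X in reverse order.
  e-reciprocal : ∀ i j xs → (∀ {x} → x ∈ xs → x ≢ 0#) → i ℕ.+ j ≡ length xs →
    e i (map _⁻¹ xs) * e (length xs) xs ≡ e j xs
  e-reciprocal zero    j       xs       _   refl = *-identityˡ _
  e-reciprocal (suc i) j       (x ∷ xs) ≢0s eq   = begin
    (e (suc i) ys + x ⁻¹ * e i ys) * e (suc (length xs)) (x ∷ xs)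
      ≡⟨ cong ((e (suc i) ys + x ⁻¹ * e i ys) *_) (e-length-∷ x xs) ⟩
    (e (suc i) ys + x ⁻¹ * e i ys) * (x * P)
      ≡⟨ solve 5 (λ u x y v p → (u :+ y :* v) :* (x :* p) := x :* (u :* p) :+ x :* y :* (v :* p))
           refl (e (suc i) ys) x (x ⁻¹) (e i ys) P ⟩
    x * (e (suc i) ys * P) + x * x ⁻¹ * (e i ys * P)
      ≡⟨ cong₂ (λ u v → x * (e (suc i) ys * P) + u * v) (inverseʳ (≢0s (here refl)))
               (e-reciprocal i j xs (≢0s ∘ there) (ℕ.suc-injective eq)) ⟩
    x * (e (suc i) ys * P) + 1# * e j xs       ≡⟨ rest j eq ⟩
    e j (x ∷ xs)                               ∎
    where
    ys = map _⁻¹ xs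
    P  = e (length xs) xs
    rest : ∀ j → suc i ℕ.+ j ≡ suc (length xs) → x * (e (suc i) ys * P) + 1# * e j xs ≡ e j (x ∷ xs)
    -- Here `i` is the length of `xs`, so the index `suc i` is out of range for `ys`.
    rest zero    eq = begin
      x * (e (suc i) ys * P) + 1# * 1#
        ≡⟨ cong (λ u → x * (u * P) + 1# * 1#)
             (e-length< ys (ℕ.≤-reflexive (≡.trans (cong suc (length-map _⁻¹ xs)) (sym (≡.trans (cong suc (sym (ℕ.+-identityʳ i))) eq))))) ⟩
      x * (0# * P) + 1# * 1#   ≡⟨ solve 2 (λ x p → x :* (con 0 :* p) :+ con 1 :* con 1 := con 1) refl x P ⟩
      1#                       ∎
    rest (suc j) eq = begin
      x * (e (suc i) ys * P) + 1# * e (suc j) xs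
        ≡⟨ cong (λ u → x * u + 1# * e (suc j) xs)
             (e-reciprocal (suc i) j xs (≢0s ∘ there) (ℕ.suc-injective (≡.trans (cong suc (sym (ℕ.+-suc i j))) eq))) ⟩
      x * e j xs + 1# * e (suc j) xs
        ≡⟨ solve 2 (λ u v → u :+ con 1 :* v := v :+ u) refl (x * e j xs) (e (suc j) xs) ⟩
      e (suc j) xs + x * e j xs  ∎

  -- The hypothesis says that the nodal polynomial of xs is X ^ (n + 1) + c. The proof divides it by X - a.
  e≡0⇒^-constant : ∀ {n xs} → length xs ≡ suc n → (∀ {j} → j ℕ.< n → e (suc j) xs ≡ 0#) →
    ∀ {a b} → a ∈ xs → b ∈ xs → a ^ suc n ≡ b ^ suc n
  e≡0⇒^-constant {n} {xs} len e≡0 {a} {b} a∈ b∈ = *-cancelˡ (^≢0 n -1≢0) (≡.trans (sym (top a∈)) (top b∈))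
    where
    s : A
    s = - 1#
    -1≢0 : s ≢ 0#
    -1≢0 -1≡0 = 0≢1 (≡.trans (sym (-‿inverseˡ 1#)) (≡.trans (cong (_+ 1#) -1≡0) (+-identityˡ 1#)))
    top : ∀ {a} → a ∈ xs → e (suc n) xs ≡ s ^ n * a ^ suc n
    top {a} a∈ with ∈⇒↭∷ a∈
    ... | ys , xs↭ = begin
      e (suc n) xs                     ≡⟨ e-resp-↭ (suc n) xs↭ ⟩
      e (suc n) ys + a * e n ys
        ≡⟨ cong₂ (λ u v → u + a * v) (e-length< ys (s≤s (ℕ.≤-reflexive len-ys))) (power n ℕ.≤-refl) ⟩
      0# + a * (s * a) ^ n             ≡⟨ cong (λ u → 0# + a * u) (^-distrib-* s a n) ⟩
      0# + a * (s ^ n * a ^ n)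
        ≡⟨ solve 3 (λ a u v → con 0 :+ a :* (u :* v) := u :* (a :* v)) refl a (s ^ n) (a ^ n) ⟩
      s ^ n * a ^ suc n                ∎
      where
      len-ys : length ys ≡ n
      len-ys = ℕ.suc-injective (≡.trans (sym (↭-length xs↭)) len)
      -- The vanishing of `e (suc j) xs` says that each `e (suc j) ys` is `- a` times the preceding
      -- one.
      power : ∀ j → j ℕ.≤ n → e j ys ≡ (s * a) ^ j
      power zero    _   = refl
      power (suc j) j<n = +-cancelˡ (a * e j ys) _ _ (begin
        a * e j ys + e (suc j) ys       ≡⟨ +-comm _ _ ⟩
        e (suc j) ys + a * e j ys       ≡⟨ e-resp-↭ (suc j) xs↭ ⟨
        e (suc j) xs                    ≡⟨ e≡0 j<n ⟩
        0#                              ≡⟨ zeroˡ _ ⟨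
        0# * (a * e j ys)               ≡⟨ cong (_* (a * e j ys)) (-‿inverseʳ 1#) ⟨
        (1# + s) * (a * e j ys)
          ≡⟨ solve 3 (λ s a v → (con 1 :+ s) :* (a :* v) := a :* v :+ (s :* a) :* v) refl s a (e j ys) ⟩
        a * e j ys + (s * a) * e j ys   ≡⟨ cong (λ u → a * e j ys + (s * a) * u) (power j (ℕ.<⇒≤ j<n)) ⟩
        a * e j ys + (s * a) ^ suc j    ∎)

-- Symmetric functions of a whole finite field and of sets with many transversals

module FiniteFieldTheory
  {A : Set} {_⊕_ _⊗_ : Op₂ A} {⊖_ : Op₁ A} {𝟘 𝟙 : A}
  (isCommutativeRing : IsCommutativeRing _≡_ _⊕_ _⊗_ ⊖_ 𝟘 𝟙)
  (_≟_ : DecidableEquality A) (0≢1 : 𝟘 ≢ 𝟙)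
  (_⁻¹ : Op₁ A) (0⁻¹≡0 : 𝟘 ⁻¹ ≡ 𝟘) (inverseʳ : ∀ {x} → x ≢ 𝟘 → x ⊗ (x ⁻¹) ≡ 𝟙)
  (elements : List A) (elements! : Unique elements) (∈-elements : ∀ x → x ∈ elements)
  where

  open ≡.≡-Reasoning
  open FieldTheory isCommutativeRing _≟_ 0≢1 _⁻¹ 0⁻¹≡0 inverseʳ public

  ↭-elements : ∀ {xs} → Unique xs → length xs ≡ length elements → xs ↭ elements
  ↭-elements xs! len = Unique-⊆⇒↭ xs! (λ _ → ∈-elements _) (ℕ.≤-reflexive (sym len))

  nonzero : ∃ λ xs → elements ↭ 0# ∷ xs
  nonzero = ∈⇒↭∷ (∈-elements 0#)

  -- Translation by 1 permutes the field and increases the sum `e 1` of all elements by the order.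
  order≡0 : fromℕ (length elements) ≡ 0#
  order≡0 = +-cancelʳ (e 1 elements) _ _ (begin
    fromℕ (length elements) + e 1 elements  ≡⟨ translate elements ⟨
    e 1 (map (1# +_) elements)
      ≡⟨ e-resp-↭ 1 (↭-elements (Unique-map (λ _ _ → +-cancelˡ 1# _ _) elements!) (length-map _ elements)) ⟩
    e 1 elements                            ≡⟨ +-identityˡ _ ⟨
    0# + e 1 elements                       ∎)
    where
    translate : ∀ xs → e 1 (map (1# +_) xs) ≡ fromℕ (length xs) + e 1 xs
    translate []       = sym (+-identityˡ 0#)
    translate (x ∷ xs) = ≡.trans (cong (_+ (1# + x) * 1#) (translate xs))
      (solve 3 (λ n u x → (n :+ u) :+ (con 1 :+ x) :* con 1 := (con 1 :+ n) :+ (u :+ x :* con 1))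
        refl (fromℕ (length xs)) (e 1 xs) x)

  -- The order is a power of `p` and vanishes in the field, which has no nilpotent elements.
  characteristic : ∀ {p} m → length elements ≡ p ℕ.^ m → fromℕ p ≡ 0#
  characteristic {p} m len = ^≡0⇒≡0 m (≡.trans (sym (power m)) (≡.trans (cong fromℕ (sym len)) order≡0))
    where
    power : ∀ m → fromℕ (p ℕ.^ m) ≡ fromℕ p ^ m
    power zero    = +-identityʳ 1#
    power (suc m) = ≡.trans (×1-homo-* p (p ℕ.^ m)) (cong (fromℕ p *_) (power m))

  -- Scaling by c permutes the field, so (c ^ j - 1) e j vanishes for every nonzero c.
  e-elements : ∀ {j} → 0 ℕ.< j → suc j ℕ.< length elements → e j elements ≡ 0#
  e-elements {j} 0<j j<Q with e j elements ≟ 0#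
  ... | yes E≡0 = E≡0
  ... | no  E≢0 with nonzero
  -- All nonzero elements, one fewer than the order, would be zeros of X ^ j - 1.
  ... | xs , els↭ = contradiction j<Q (ℕ.≤⇒≯ (subst (ℕ._≤ suc j) (sym (↭-length els↭)) (s≤s
      (^≡1-length≤ j 0<j xs! λ x∈ → cʲ≡1 (λ { refl → Unique[x∷xs]⇒x∉xs 0∷xs! x∈ })))))
    where
    0∷xs! : Unique (0# ∷ xs)
    0∷xs! = Unique-resp-↭ els↭ elements!
    xs! : Unique xs
    xs! with _ ∷ u ← 0∷xs! = u
    cʲ≡1 : ∀ {c} → c ≢ 0# → c ^ j ≡ 1#
    cʲ≡1 {c} c≢0 = *-cancelˡ E≢0 (begin
      e j elements * c ^ j          ≡⟨ *-comm _ _ ⟩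
      c ^ j * e j elements          ≡⟨ e-scale c j elements ⟨
      e j (map (c *_) elements)
        ≡⟨ e-resp-↭ j (↭-elements (Unique-map (λ _ _ → *-cancelˡ c≢0) elements!) (length-map _ elements)) ⟩
      e j elements                  ≡⟨ *-identityʳ _ ⟨
      e j elements * 1#             ∎)

  Transversal : List A → A → Set
  Transversal xs y = ∀ {a b a′ b′} → a ∈ xs → b ∈ xs → a′ ∈ xs → b′ ∈ xs →
    a + y * b ≡ a′ + y * b′ → a ≡ a′ × b ≡ b′

  module _ {p-1 k : ℕ} (prime : Prime (suc p-1)) (order : length elements ≡ (suc p-1 ℕ.^ k) ℕ.^ 2) where

    private
      q : ℕ
      q = suc p-1 ℕ.^ k

    open PrimeCharacteristic prime (characteristic (k ℕ.* 2) (≡.trans order (ℕ.^-*-assoc (suc p-1) k 2))) public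

    q*q≡order : q ℕ.* q ≡ length elements
    q*q≡order = sym (≡.trans order (cong (q ℕ.*_) (ℕ.*-identityʳ q)))

    -- For the transversal y the multiset xs + y xs is the whole field; e (i q) is a polynomial in y
    -- of degree at most i q, which therefore vanishes also at y = 0.
    e-transversal : ∀ {xs ys i} → Unique xs → length xs ≡ q → Unique ys → (∀ {y} → y ∈ ys → Transversal xs y) →
      0 ℕ.< i → i ℕ.* q ℕ.< length ys → suc (i ℕ.* q) ℕ.< length elements → e i xs ≡ 0#
    e-transversal {xs} {ys} {i@(suc i-1)} xs! len ys! transversal _ iq<ys iq<Q = ^≡0⇒≡0 q (begin
      e i xs ^ q                              ≡⟨ e-copies k i xs ⟨
      e (i ℕ.* q) (concatMap (replicate q) xs)  ≡⟨ cong (e (i ℕ.* q)) (at-zero xs) ⟨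
      e (i ℕ.* q) (map (f 0#) pairs)
        ≡⟨ roots (i ℕ.* q) ys (Degree≤-e (i ℕ.* q) pairs) ys! iq<ys root 0# ⟩
      0#                                      ∎)
      where
      pairs = cartesianProduct xs xs
      f : A → A × A → A
      f y p = proj₁ p + y * proj₂ p
      root : ∀ {y} → y ∈ ys → e (i ℕ.* q) (map (f y) pairs) ≡ 0#
      root {y} y∈ = ≡.trans (e-resp-↭ (i ℕ.* q) (↭-elements (Unique-map inj (cartesianProduct⁺ xs! xs!)) len-f))
                           (e-elements (ℕ.*-mono-≤ (s≤s (z≤n {i-1})) (ℕ.m^n>0 (suc p-1) k)) iq<Q)
        where
        inj : ∀ {u v} → u ∈ pairs → v ∈ pairs → f y u ≡ f y v → u ≡ v
        inj u∈ v∈ eq with ∈-cartesianProduct⁻ xs xs u∈ | ∈-cartesianProduct⁻ xs xs v∈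
        ... | a∈ , b∈ | a′∈ , b′∈ with transversal y∈ a∈ b∈ a′∈ b′∈ eq
        ... | refl , refl = refl
        len-f : length (map (f y) pairs) ≡ length elements
        len-f = begin
          length (map (f y) pairs)  ≡⟨ length-map (f y) pairs ⟩
          length pairs              ≡⟨ length-cartesianProduct xs xs ⟩
          length xs ℕ.* length xs   ≡⟨ cong₂ ℕ._*_ len len ⟩
          q ℕ.* q                   ≡⟨ q*q≡order ⟩
          length elements           ∎
      row : ∀ x zs → map (f 0#) (map (x ,_) zs) ≡ replicate (length zs) x
      row x []       = refl
      row x (z ∷ zs) = cong₂ _∷_ (≡.trans (cong (x +_) (zeroˡ z)) (+-identityʳ x)) (row x zs)
      at-zero : ∀ zs → map (f 0#) (cartesianProduct zs xs) ≡ concatMap (replicate q) zs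
      at-zero []       = refl
      at-zero (z ∷ zs) = ≡.trans (map-++ (f 0#) (map (z ,_) xs) _)
        (cong₂ _++_ (≡.trans (row z xs) (cong (λ n → replicate n z) len)) (at-zero zs))

    module _ {xs ys} (xs! : Unique xs) (len : length xs ≡ q) (0∈xs : 0# ∈ xs) (1∈xs : 1# ∈ xs)
             (ys! : Unique ys) (many : length elements ℕ.< 2 ℕ.* length ys)
             (transversal : ∀ {y} → y ∈ ys → Transversal xs y)
             (transversal⁻¹ : ∀ {y} → y ∈ ys → Transversal (map _⁻¹ xs) y) where

      private
        us : List A
        us = proj₁ (∈⇒↭∷ 0∈xs)
        xs↭ : xs ↭ 0# ∷ us
        xs↭ = proj₂ (∈⇒↭∷ 0∈xs)
        0∷us! : Unique (0# ∷ us)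
        0∷us! = Unique-resp-↭ xs↭ xs!
        us! : Unique us
        us! with _ ∷ u ← 0∷us! = u
        us≢0 : ∀ {x} → x ∈ us → x ≢ 0#
        us≢0 x∈ refl = Unique[x∷xs]⇒x∉xs 0∷us! x∈
        q≡ : q ≡ suc (length us)
        q≡ = ≡.trans (sym len) (↭-length xs↭)

        e-0∷ : ∀ i vs → e i (0# ∷ vs) ≡ e i vs
        e-0∷ zero    vs = refl
        e-0∷ (suc i) vs = ≡.trans (cong (e (suc i) vs +_) (zeroˡ _)) (+-identityʳ _)

        -- Stated for any `vs` because it serves both `xs` and its reciprocals. From 2 i < q follows
        -- 2 i q < q², so i q stays below the number of transversal directions.
        low : ∀ {vs} → Unique vs → length vs ≡ q → (∀ {y} → y ∈ ys → Transversal vs y) →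
              ∀ {i ws} → vs ↭ 0# ∷ ws → 0 ℕ.< i → 2 ℕ.* i ℕ.< q → e i ws ≡ 0#
        low {vs} vs! len t {i@(suc i-1)} {ws} vs↭ 0<i 2i<q = begin
          e i ws          ≡⟨ e-0∷ i ws ⟨
          e i (0# ∷ ws)   ≡⟨ e-resp-↭ i vs↭ ⟨
          e i vs          ≡⟨ e-transversal {i = i} vs! len ys! t 0<i iq<ys iq+1<Q ⟩
          0#              ∎
          where
          q>0 : 0 ℕ.< q
          q>0 = ℕ.m^n>0 (suc p-1) k
          2iq<Q : 2 ℕ.* (i ℕ.* q) ℕ.< length elements
          2iq<Q = subst₂ ℕ._<_ (ℕ.*-assoc 2 i q) q*q≡order (ℕ.*-monoˡ-< q {{ℕ.>-nonZero q>0}} 2i<q)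
          iq<ys : i ℕ.* q ℕ.< length ys
          iq<ys = ℕ.*-cancelˡ-< 2 _ _ (ℕ.<-trans 2iq<Q many)
          iq+1<Q : suc (i ℕ.* q) ℕ.< length elements
          iq+1<Q = ℕ.≤-<-trans (ℕ.+-mono-≤ (ℕ.*-mono-≤ (s≤s (z≤n {i-1})) q>0) (ℕ.m≤m+n (i ℕ.* q) 0))
            2iq<Q

        -- One of j and n - j is less than q / 2 = (n + 1) / 2, and inversion exchanges both.
        e-us : ∀ {n} → length us ≡ n → ∀ {j} → 0 ℕ.< j → j ℕ.< n → e j us ≡ 0#
        e-us {n} len-us {j} 0<j j<n with 2 ℕ.* j ℕ.<? q
        ... | yes 2j<q = low xs! len transversal xs↭ 0<j 2j<q
        ... | no  2j≮q = begin
          e j us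
            ≡⟨ e-reciprocal (n ℕ.∸ j) j us us≢0 (≡.trans (ℕ.m∸n+n≡m (ℕ.<⇒≤ j<n)) (sym len-us)) ⟨
          e (n ℕ.∸ j) (map _⁻¹ us) * e (length us) us
            ≡⟨ cong (_* e (length us) us) (low (Unique-map (λ _ _ → ⁻¹-injective) xs!) (≡.trans (length-map _⁻¹ xs) len)
                 transversal⁻¹ xs⁻¹↭ (ℕ.m<n⇒0<n∸m j<n) small) ⟩
          0# * e (length us) us              ≡⟨ zeroˡ _ ⟩
          0#                                 ∎
          where
          xs⁻¹↭ : map _⁻¹ xs ↭ 0# ∷ map _⁻¹ us
          xs⁻¹↭ = subst (λ z → map _⁻¹ xs ↭ z ∷ map _⁻¹ us) 0⁻¹≡0 (↭-map⁺ _⁻¹ xs↭)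
          q≡1+n : q ≡ suc n
          q≡1+n = ≡.trans q≡ (cong suc len-us)
          small : 2 ℕ.* (n ℕ.∸ j) ℕ.< q
          small = subst₂ ℕ._<_ (sym (ℕ.*-distribˡ-∸ 2 n j)) (sym q≡1+n) (s≤s (ℕ.m≤n+o⇒m∸n≤o (2 ℕ.* n) (2 ℕ.* j) bound))
            where
            bound : 2 ℕ.* n ℕ.≤ 2 ℕ.* j ℕ.+ n
            bound = ℕ.≤-trans (ℕ.≤-reflexive (cong (n ℕ.+_) (ℕ.+-identityʳ n)))
              (ℕ.+-monoˡ-≤ n (ℕ.≤-trans (ℕ.n≤1+n n) (subst (ℕ._≤ 2 ℕ.* j) q≡1+n (ℕ.≮⇒≥ 2j≮q))))

        1∈us : 1# ∈ us
        1∈us = ∈-∷⁻ (∈-resp-↭ xs↭ 1∈xs) (0≢1 ∘ sym)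

        -- The vanishing symmetric functions make `x ^ n` constant on `us`, and the element 1
        -- determines the constant.
        us^ : ∀ {n} → length us ≡ n → ∀ {x} → x ∈ us → x ^ n ≡ 1#
        us^ {zero}  len-us x∈ = refl
        us^ {suc n} len-us x∈ = ≡.trans
          (e≡0⇒^-constant len-us (λ j<n → e-us len-us (s≤s z≤n) (s≤s j<n)) x∈ 1∈us) (1^ (suc n))

        0<length : 0 ℕ.< length us
        0<length with us | 1∈us
        ... | _ ∷ _ | _ = s≤s z≤n

      ∈⇒fixed : ∀ {x} → x ∈ xs → x ^ q ≡ x
      ∈⇒fixed {x} x∈ with ∈-resp-↭ xs↭ x∈
      ... | here refl  = ≡.trans (cong (0# ^_) q≡) (zeroˡ _)
      ... | there x∈us = begin
        x ^ q                 ≡⟨ cong (x ^_) q≡ ⟩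
        x * x ^ length us     ≡⟨ cong (x *_) (us^ refl x∈us) ⟩
        x * 1#                ≡⟨ *-identityʳ x ⟩
        x                     ∎

      -- A further fixed point, together with the q - 1 entries of `us`, would give X ^ (q - 1) - 1
      -- too many zeros.
      fixed⇒∈ : ∀ {x} → x ^ q ≡ x → x ∈ xs
      fixed⇒∈ {x} xq≡x with x ≟ 0# | x ∈? us
        where open import Data.List.Membership.DecPropositional _≟_ using (_∈?_)
      ... | yes refl | _       = 0∈xs
      ... | no _     | yes x∈  = ∈-resp-↭ (↭-sym xs↭) (there x∈)
      ... | no x≢0   | no x∉   = contradiction
        (^≡1-length≤ (length us) 0<length (¬Any⇒All¬ us x∉ ∷ us!) all^) (ℕ.<⇒≱ (ℕ.n<1+n _))
        where
        all^ : ∀ {z} → z ∈ x ∷ us → z ^ length us ≡ 1#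
        all^ (here refl) = *-cancelˡ x≢0 (≡.trans (cong (x ^_) (sym q≡)) (≡.trans xq≡x (sym (*-identityʳ x))))
        all^ (there z∈)  = us^ refl z∈

-- Cliques

-- The hypothesis with C = m / s, with both sides multiplied by 2 s ^ 5 and moved so that no subtraction occurs.
clear-denominators : ∀ m s .{{_ : ℕ.NonZero s}} n →
  ((ℤ.+ m ℚ./ s) ^ℚ 6) ℚ.* (ℤ.+ s ℚ./ 1) ℚ.≤ (ℤ.+ n ℤ.- ℤ.+ 3) ℚ./ 2 →
  2 ℕ.* m ℕ.^ 6 ℕ.+ 3 ℕ.* s ℕ.^ 5 ℕ.≤ n ℕ.* s ℕ.^ 5
clear-denominators m s@(suc s-1) n h = ℕ.*-cancelʳ-≤ _ _ s (ℤ.drop‿+≤+ (begin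
  ℤ.+ ((2 ℕ.* m ℕ.^ 6 ℕ.+ 3 ℕ.* s ℕ.^ 5) ℕ.* s)
    ≡⟨ cong ℤ.+_ (solve 2 (λ m s → (con 2 :* m :^ 6 :+ con 3 :* s :^ 5) :* s
         := (m :^ 6 :* s) :* con 2 :+ con 3 :* (s :^ 6 :* con 1)) refl m s) ⟩
  ℤ.+ (N ℕ.* 2 ℕ.+ 3 ℕ.* D)             ≡⟨ ℤ.pos-+ (N ℕ.* 2) (3 ℕ.* D) ⟩
  ℤ.+ (N ℕ.* 2) ℤ.+ ℤ.+ (3 ℕ.* D)       ≤⟨ ℤ.+-monoˡ-≤ (ℤ.+ (3 ℕ.* D)) main ⟩
  (ℤ.+ n ℤ.- ℤ.+ 3) ℤ.* ℤ.+ D ℤ.+ ℤ.+ (3 ℕ.* D)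
    ≡⟨ cong (λ i → (ℤ.+ n ℤ.- ℤ.+ 3) ℤ.* ℤ.+ D ℤ.+ i) (ℤ.pos-* 3 D) ⟩
  (ℤ.+ n ℤ.- ℤ.+ 3) ℤ.* ℤ.+ D ℤ.+ ℤ.+ 3 ℤ.* ℤ.+ D
    ≡⟨ ℤ.*-distribʳ-+ (ℤ.+ D) (ℤ.+ n ℤ.- ℤ.+ 3) (ℤ.+ 3) ⟨
  (ℤ.+ n ℤ.- ℤ.+ 3 ℤ.+ ℤ.+ 3) ℤ.* ℤ.+ D
    ≡⟨ cong (ℤ._* ℤ.+ D) (≡.trans (ℤ.+-assoc (ℤ.+ n) (ℤ.- ℤ.+ 3) (ℤ.+ 3)) (ℤ.+-identityʳ (ℤ.+ n))) ⟩
  ℤ.+ n ℤ.* ℤ.+ D                       ≡⟨ ℤ.pos-* n D ⟨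
  ℤ.+ (n ℕ.* D)
    ≡⟨ cong ℤ.+_ (solve 2 (λ n s → n :* (s :^ 6 :* con 1) := n :* s :^ 5 :* s) refl n s) ⟩
  ℤ.+ (n ℕ.* s ℕ.^ 5 ℕ.* s)             ∎))
  where
  open ℤ.≤-Reasoning
  open +-*-Solver
  N D : ℕ
  N = m ℕ.^ 6 ℕ.* s
  D = s ℕ.^ 6 ℕ.* 1
  -- Unnormalised fractions keep numerator and denominator as written, whereas in `ℚ` the common
  -- factors of `m` and `s` are cancelled.
  C S : ℚᵘ.ℚᵘ
  C = ℚᵘ.mkℚᵘ (ℤ.+ m) s-1
  S = ℚᵘ.mkℚᵘ (ℤ.+ s) 0
  power : ℕ → ℚᵘ.ℚᵘ
  power zero    = ℚᵘ.1ℚᵘ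
  power (suc k) = C ℚᵘ.* power k
  power-≃ : ∀ k → ℚ.toℚᵘ ((ℤ.+ m ℚ./ s) ^ℚ k) ℚᵘ.≃ power k
  power-≃ zero    = ℚᵘ.≃-refl
  power-≃ (suc k) =
    ℚᵘ.≃-trans (ℚ.toℚᵘ-homo-* (ℤ.+ m ℚ./ s) ((ℤ.+ m ℚ./ s) ^ℚ k)) (ℚᵘ.*-cong (ℚ.toℚᵘ-fromℚᵘ C) (power-≃ k))
  ↥-* : ∀ p r → ℚᵘ.↥ (p ℚᵘ.* r) ≡ ℚᵘ.↥ p ℤ.* ℚᵘ.↥ r
  ↥-* (ℚᵘ.mkℚᵘ _ _) (ℚᵘ.mkℚᵘ _ _) = refl
  numerator : ∀ k → ℚᵘ.↥ power k ≡ ℤ.+ (m ℕ.^ k)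
  numerator zero    = refl
  numerator (suc k) = ≡.trans (↥-* C (power k)) (≡.trans (cong (ℤ.+ m ℤ.*_) (numerator k)) (sym (ℤ.pos-* m (m ℕ.^ k))))
  unnormalised : power 6 ℚᵘ.* S ℚᵘ.≤ ℚᵘ.mkℚᵘ (ℤ.+ n ℤ.- ℤ.+ 3) 1
  unnormalised = ℚᵘ.≤-respʳ-≃ (ℚ.toℚᵘ-fromℚᵘ (ℚᵘ.mkℚᵘ (ℤ.+ n ℤ.- ℤ.+ 3) 1))
    (ℚᵘ.≤-respˡ-≃ (ℚᵘ.≃-trans (ℚ.toℚᵘ-homo-* ((ℤ.+ m ℚ./ s) ^ℚ 6) (ℤ.+ s ℚ./ 1)) (ℚᵘ.*-cong (power-≃ 6) (ℚ.toℚᵘ-fromℚᵘ S)))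
      (ℚ.toℚᵘ-mono-≤ h))
  main : ℤ.+ (N ℕ.* 2) ℤ.≤ (ℤ.+ n ℤ.- ℤ.+ 3) ℤ.* ℤ.+ D
  main = subst (ℤ._≤ (ℤ.+ n ℤ.- ℤ.+ 3) ℤ.* ℤ.+ D)
    (≡.trans (cong (λ i → i ℤ.* ℤ.+ s ℤ.* ℤ.+ 2) (numerator 6))
      (≡.trans (cong (ℤ._* ℤ.+ 2) (sym (ℤ.pos-* (m ℕ.^ 6) s))) (sym (ℤ.pos-* N 2))))
    (ℚᵘ.drop-*≤* unnormalised)

-- The field structure carried over to the indices

module Transport {c ℓ : Level} {n : ℕ} (F : FiniteField c ℓ n) where

  open FiniteField F using (_≈_; 0#; 1#; index; element; enumeration; 0≉1; invertible)
  private module F = FiniteField F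

  element-index : ∀ x → element (index x) ≈ x
  element-index = Inverse.strictlyInverseʳ enumeration

  index-element : ∀ i → index (element i) ≡ i
  index-element = Inverse.strictlyInverseˡ enumeration

  index-cong : ∀ {x y} → x ≈ y → index x ≡ index y
  index-cong = Inverse.to-cong enumeration

  index-injective : ∀ {x y} → index x ≡ index y → x ≈ y
  index-injective {x} {y} eq =
    F.trans (F.sym (element-index x)) (F.trans (F.reflexive (cong element eq)) (element-index y))

  infixl 6 _⊕_
  infixl 7 _⊗_
  infix  8 ⊖_

  -- On indices equality is propositional and decidable, and the given subsets are already sets of
  -- indices.
  _⊕_ _⊗_ : Op₂ (Fin n)
  i ⊕ j = index (element i F.+ element j)
  i ⊗ j = index (element i F.* element j)

  ⊖_ : Op₁ (Fin n)
  ⊖ i = index (F.- element i)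

  𝟘 𝟙 : Fin n
  𝟘 = index 0#
  𝟙 = index 1#

  indexRawRing : RawRing 0ℓ 0ℓ
  indexRawRing = record
    { Carrier = Fin n ; _≈_ = _≡_ ; _+_ = _⊕_ ; _*_ = _⊗_ ; -_ = ⊖_ ; 0# = 𝟘 ; 1# = 𝟙 }

  element-isRingMonomorphism : IsRingMonomorphism indexRawRing F.rawRing element
  element-isRingMonomorphism = record
    { isRingHomomorphism = record
      { isSemiringHomomorphism = record
        { isNearSemiringHomomorphism = record
          { +-isMonoidHomomorphism = record
            { isMagmaHomomorphism = record
              { isRelHomomorphism = record { cong = F.reflexive ∘ cong element }
              ; homo = λ _ _ → element-index _ }
            ; ε-homo = element-index _ }
          ; *-homo = λ _ _ → element-index _ }
        ; 1#-homo = element-index _ }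
      ; -‿homo = λ _ → element-index _ }
    ; injective = λ eq → ≡.trans (sym (index-element _)) (≡.trans (index-cong eq) (index-element _)) }

  isCommutativeRing : IsCommutativeRing _≡_ _⊕_ _⊗_ ⊖_ 𝟘 𝟙
  isCommutativeRing = RingMonomorphism.isCommutativeRing element-isRingMonomorphism F.isCommutativeRing

  index-+ : ∀ x y → index (x F.+ y) ≡ index x ⊕ index y
  index-+ x y = index-cong (F.+-cong (F.sym (element-index x)) (F.sym (element-index y)))

  index-* : ∀ x y → index (x F.* y) ≡ index x ⊗ index y
  index-* x y = index-cong (F.*-cong (F.sym (element-index x)) (F.sym (element-index y)))

  index-neg : ∀ x → index (F.- x) ≡ ⊖ index x
  index-neg x = index-cong (F.-‿cong (F.sym (element-index x)))

  𝟘≢𝟙 : 𝟘 ≢ 𝟙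
  𝟘≢𝟙 = 0≉1 ∘ index-injective

  element≈0⇒≡𝟘 : ∀ {i} → element i ≈ 0# → i ≡ 𝟘
  element≈0⇒≡𝟘 {i} eq = ≡.trans (sym (index-element i)) (index-cong eq)

  -- Sending 0 to 0 makes inversion a total involution, which keeps 0 in the set of reciprocals of a
  -- clique.
  reciprocal : ∀ i → ∃ λ j → (i ≡ 𝟘 → j ≡ 𝟘) × (i ≢ 𝟘 → i ⊗ j ≡ 𝟙)
  reciprocal i with i ≟ᶠ 𝟘
  ... | yes i≡0 = 𝟘 , (λ _ → refl) , contradiction i≡0
  ... | no  i≢0 with invertible (element i) (i≢0 ∘ element≈0⇒≡𝟘)
  ... | y , xy≈1 = index y , (λ i≡0 → contradiction i≡0 i≢0) ,
    λ _ → index-cong (F.trans (F.*-congˡ (element-index y)) xy≈1)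

  infix 8 _⁻¹
  _⁻¹ : Op₁ (Fin n)
  _⁻¹ = proj₁ ∘ reciprocal

  𝟘⁻¹≡𝟘 : 𝟘 ⁻¹ ≡ 𝟘
  𝟘⁻¹≡𝟘 = proj₁ (proj₂ (reciprocal 𝟘)) refl

  ⊗-inverseʳ : ∀ {i} → i ≢ 𝟘 → i ⊗ (i ⁻¹) ≡ 𝟙
  ⊗-inverseʳ {i} = proj₂ (proj₂ (reciprocal i))

  open FiniteFieldTheory isCommutativeRing _≟ᶠ_ 𝟘≢𝟙 _⁻¹ 𝟘⁻¹≡𝟘 ⊗-inverseʳ (allFin n) (allFin⁺ n) ∈-allFin public
    using ( Transversal; ∈⇒fixed; fixed⇒∈; *-cancelˡ; *≢0; [x-y]+y; +-cancelˡ; +-cancelʳ; frobenius; ^-distrib-*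
          ; *-closed⇒^≡1; 0^; 1^; solve; _:=_; _:+_; _:*_)
    renaming (_^_ to _^ᶠ_)
  open IsCommutativeRing isCommutativeRing public
    using (*-isCommutativeMonoid)
    renaming ( +-assoc to ⊕-assoc; +-identityʳ to ⊕-identityʳ; -‿inverseʳ to ⊖-inverseʳ
             ; *-comm to ⊗-comm; *-identityˡ to ⊗-identityˡ; *-identityʳ to ⊗-identityʳ; zeroˡ to ⊗-zeroˡ)
  open ProductSets (IsCommutativeMonoid.isCommutativeSemigroup *-isCommutativeMonoid) public

  nonzero⇒cancellable : ∀ {i} → i ≢ 𝟘 → Cancellable i
  nonzero⇒cancellable {i} i≢0 {x} {y} eq = *-cancelˡ i≢0 (≡.trans (⊗-comm i x) (≡.trans eq (⊗-comm y i)))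

  x⊕y≡z⇒x≡z-y : ∀ {x y z} → x ⊕ y ≡ z → x ≡ z ⊕ ⊖ y
  x⊕y≡z⇒x≡z-y {x} {y} {z} eq = begin
    x                 ≡⟨ ⊕-identityʳ x ⟨
    x ⊕ 𝟘             ≡⟨ cong (x ⊕_) (⊖-inverseʳ y) ⟨
    x ⊕ (y ⊕ ⊖ y)     ≡⟨ ⊕-assoc x y (⊖ y) ⟨
    x ⊕ y ⊕ ⊖ y       ≡⟨ cong (_⊕ ⊖ y) eq ⟩
    z ⊕ ⊖ y           ∎
    where open ≡.≡-Reasoning

  difference-quotient : ∀ {a b a′ b′ y} → a ⊕ (y ⊗ b) ≡ a′ ⊕ (y ⊗ b′) → a ⊕ ⊖ a′ ≡ y ⊗ (b′ ⊕ ⊖ b)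
  difference-quotient {a} {b} {a′} {b′} {y} eq = +-cancelʳ (a′ ⊕ (y ⊗ b)) _ _ (begin
    u ⊕ (a′ ⊕ (y ⊗ b))        ≡⟨ ⊕-assoc u a′ (y ⊗ b) ⟨
    (u ⊕ a′) ⊕ (y ⊗ b)        ≡⟨ cong (_⊕ (y ⊗ b)) ([x-y]+y a a′) ⟩
    a ⊕ (y ⊗ b)               ≡⟨ eq ⟩
    a′ ⊕ (y ⊗ b′)             ≡⟨ cong (λ z → a′ ⊕ (y ⊗ z)) ([x-y]+y b′ b) ⟨
    a′ ⊕ (y ⊗ (v ⊕ b))
      ≡⟨ solve 4 (λ a y v b → a :+ y :* (v :+ b) := y :* v :+ (a :+ y :* b)) refl a′ y v b ⟩
    (y ⊗ v) ⊕ (a′ ⊕ (y ⊗ b))  ∎)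
    where
    open ≡.≡-Reasoning
    u = a ⊕ ⊖ a′
    v = b′ ⊕ ⊖ b

  -- A coincidence of two sums writes `y` as a quotient of two differences. If one difference is
  -- zero, cancellation shows that the other is too.
  transversal : ∀ {xs y} → y ≢ 𝟘 →
    (∀ {a b a′ b′} → a ∈ xs → b ∈ xs → a′ ∈ xs → b′ ∈ xs → a ≢ a′ → b′ ≢ b →
       a ⊕ ⊖ a′ ≢ y ⊗ (b′ ⊕ ⊖ b)) →
    Transversal xs y
  transversal {xs} {y} y≢0 avoid {a} {b} {a′} {b′} a∈ b∈ a′∈ b′∈ eq with a ≟ᶠ a′ | b′ ≟ᶠ b
  ... | yes refl | yes refl = refl , refl
  ... | yes refl | no _     = refl , *-cancelˡ y≢0 (+-cancelˡ a _ _ eq)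
  ... | no a≢a′  | yes refl = contradiction (+-cancelʳ (y ⊗ b) _ _ eq) a≢a′
  ... | no a≢a′  | no b′≢b  = contradiction (difference-quotient eq) (avoid a∈ b∈ a′∈ b′∈ a≢a′ b′≢b)

  -- Directions avoided by a clique and by its reciprocals

  module Clique (S : Subset n) (0∉S : ∀ {i} → i Sub.∈ S → i ≢ 𝟘)
                (A : Subset n) (0∈A : 𝟘 Sub.∈ A)
                (clique : ∀ {i j} → i Sub.∈ A → j Sub.∈ A → i ≢ j → (i ⊕ ⊖ j) Sub.∈ S) where

    D : Subset n
    D = quotients (S ⊙ S ⊙ S)

    ∈A⇒∈S : ∀ {i} → i Sub.∈ A → i ≢ 𝟘 → i Sub.∈ S
    ∈A⇒∈S {i} i∈ i≢0 = subst (Sub._∈ S) (sym (x⊕y≡z⇒x≡z-y (⊕-identityʳ i))) (clique i∈ 0∈A i≢0)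

    ∈D : ∀ {y t} → t Sub.∈ S ⊙ S ⊙ S → (y ⊗ t) Sub.∈ S ⊙ S ⊙ S → y Sub.∈ D
    ∈D {y} {t} t∈ yt∈ = ∈-comprehension⁺ (isQuotient? (S ⊙ S ⊙ S)) (t , t∈ , yt∈)

    directions : List (Fin n)
    directions = toList (∁ (⁅ 𝟘 ⁆ ∪ D))

    directions! : Unique directions
    directions! = toList-Unique (∁ (⁅ 𝟘 ⁆ ∪ D))

    ∈-directions⁻ : ∀ {y} → y ∈ directions → y ≢ 𝟘 × ¬ y Sub.∈ D
    ∈-directions⁻ {y} y∈ = (λ { refl → y∉ (Sub.p⊆p∪q D (Sub.x∈⁅x⁆ 𝟘)) }) , y∉ ∘ Sub.q⊆p∪q ⁅ 𝟘 ⁆ D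
      where
      y∉ : ¬ y Sub.∈ ⁅ 𝟘 ⁆ ∪ D
      y∉ = Sub.x∈∁p⇒x∉p (∈-toList⁻ (∁ (⁅ 𝟘 ⁆ ∪ D)) y∈)

    -- A coincidence gives u = y v with u and v in `S`. Multiplication by `s ⊗ s` places both sides
    -- in `S ⊙ S ⊙ S`, against `y` lying outside `D`.
    A-transversal : ∀ {s y} → s Sub.∈ S → y ∈ directions → Transversal (toList A) y
    A-transversal {s} {y} s∈ y∈ = transversal (proj₁ (∈-directions⁻ y∈)) λ a∈ b∈ a′∈ b′∈ a≢a′ b′≢b eq →
      proj₂ (∈-directions⁻ y∈) (∈D {t = _ ⊗ s ⊗ s} (∈-⊙⁺ (∈-⊙⁺ (clique (∈-toList⁻ A b′∈) (∈-toList⁻ A b∈) b′≢b) s∈) s∈)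
        (subst (Sub._∈ S ⊙ S ⊙ S)
          (≡.trans (cong (λ z → z ⊗ s ⊗ s) eq) (solve 3 (λ y v s → y :* v :* s :* s := y :* (v :* s :* s)) refl y _ s))
          (∈-⊙⁺ (∈-⊙⁺ (clique (∈-toList⁻ A a∈) (∈-toList⁻ A a′∈) a≢a′) s∈) s∈)))

    -- 1 / a - 1 / b = (b - a) / (a b)
    reciprocal-difference : ∀ {a b} → a Sub.∈ A → b Sub.∈ A → a ⁻¹ ≢ b ⁻¹ →
      ∃ λ r → r Sub.∈ S ⊙ S × ((a ⁻¹ ⊕ ⊖ (b ⁻¹)) ⊗ r) Sub.∈ S
    reciprocal-difference {a} {b} a∈ b∈ a⁻¹≢b⁻¹ = go (a ≟ᶠ 𝟘) (b ≟ᶠ 𝟘)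
      where
      open ≡.≡-Reasoning
      w = a ⁻¹ ⊕ ⊖ (b ⁻¹)
      a≢b : a ≢ b
      a≢b = a⁻¹≢b⁻¹ ∘ cong _⁻¹
      expand : ∀ c → (w ⊗ c) ⊕ (b ⁻¹ ⊗ c) ≡ a ⁻¹ ⊗ c
      expand c =
        ≡.trans (solve 3 (λ w c b → w :* c :+ b :* c := (w :+ b) :* c) refl w c (b ⁻¹)) (cong (_⊗ c) ([x-y]+y (a ⁻¹) (b ⁻¹)))
      cancel-inverse : ∀ {x} y → x ≢ 𝟘 → x ⁻¹ ⊗ (x ⊗ y) ≡ y
      cancel-inverse {x} y x≢0 = begin
        x ⁻¹ ⊗ (x ⊗ y)    ≡⟨ solve 3 (λ u x y → u :* (x :* y) := x :* u :* y) refl (x ⁻¹) x y ⟩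
        x ⊗ x ⁻¹ ⊗ y      ≡⟨ cong (_⊗ y) (⊗-inverseʳ x≢0) ⟩
        𝟙 ⊗ y             ≡⟨ ⊗-identityˡ y ⟩
        y                 ∎
      𝟘⁻¹⊗ : ∀ c → 𝟘 ⁻¹ ⊗ c ≡ 𝟘
      𝟘⁻¹⊗ c = ≡.trans (cong (_⊗ c) 𝟘⁻¹≡𝟘) (⊗-zeroˡ c)
      go : Dec (a ≡ 𝟘) → Dec (b ≡ 𝟘) → ∃ λ r → r Sub.∈ S ⊙ S × (w ⊗ r) Sub.∈ S
      go (yes refl) (yes refl) = contradiction refl a≢b
      go (yes refl) (no b≢0)   = b ⊗ b , ∈-⊙⁺ (∈A⇒∈S b∈ b≢0) (∈A⇒∈S b∈ b≢0) ,
        subst (Sub._∈ S) (sym (x⊕y≡z⇒x≡z-y (≡.trans (cong ((w ⊗ (b ⊗ b)) ⊕_) (sym (cancel-inverse b b≢0)))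
          (≡.trans (expand (b ⊗ b)) (𝟘⁻¹⊗ (b ⊗ b)))))) (clique a∈ b∈ a≢b)
      go (no a≢0)   (yes refl) = a ⊗ a , ∈-⊙⁺ (∈A⇒∈S a∈ a≢0) (∈A⇒∈S a∈ a≢0) ,
        subst (Sub._∈ S) (sym (x⊕y≡z⇒x≡z-y (≡.trans (cong ((w ⊗ (a ⊗ a)) ⊕_) (sym (𝟘⁻¹⊗ (a ⊗ a))))
          (≡.trans (expand (a ⊗ a)) (cancel-inverse a a≢0))))) (clique a∈ b∈ a≢b)
      go (no a≢0)   (no b≢0)   = a ⊗ b , ∈-⊙⁺ (∈A⇒∈S a∈ a≢0) (∈A⇒∈S b∈ b≢0) ,
        subst (Sub._∈ S) (sym (x⊕y≡z⇒x≡z-y (≡.trans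
          (cong ((w ⊗ (a ⊗ b)) ⊕_) (sym (≡.trans (cong (b ⁻¹ ⊗_) (⊗-comm a b)) (cancel-inverse a b≢0))))
          (≡.trans (expand (a ⊗ b)) (cancel-inverse b a≢0))))) (clique b∈ a∈ (a≢b ∘ sym))

    -- Let u = y v be differences of reciprocals with u r and v r′ in `S`, where r and r′ are in
    -- `S ⊙ S`. Then r′ (u r) = y (r (v r′)) has three factors from `S` on each side of the
    -- quotient, which is where the size of `D` comes from.
    A⁻¹-transversal : ∀ {y} → y ∈ directions → Transversal (map _⁻¹ (toList A)) y
    A⁻¹-transversal {y} y∈ = transversal (proj₁ (∈-directions⁻ y∈)) avoid
      where
      avoid : ∀ {a b a′ b′} → a ∈ map _⁻¹ (toList A) → b ∈ map _⁻¹ (toList A) →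
        a′ ∈ map _⁻¹ (toList A) → b′ ∈ map _⁻¹ (toList A) → a ≢ a′ → b′ ≢ b → a ⊕ ⊖ a′ ≢ y ⊗ (b′ ⊕ ⊖ b)
      avoid a∈ b∈ a′∈ b′∈ a≢a′ b′≢b eq with ∈-map⁻ _⁻¹ a∈ | ∈-map⁻ _⁻¹ b∈ | ∈-map⁻ _⁻¹ a′∈ | ∈-map⁻ _⁻¹ b′∈
      ... | a , a∈A , refl | b , b∈A , refl | a′ , a′∈A , refl | b′ , b′∈A , refl
        with reciprocal-difference (∈-toList⁻ A a∈A) (∈-toList⁻ A a′∈A) a≢a′
           | reciprocal-difference (∈-toList⁻ A b′∈A) (∈-toList⁻ A b∈A) b′≢b
      ... | r , r∈ , ur∈ | r′ , r′∈ , vr′∈ = proj₂ (∈-directions⁻ y∈) (∈D {t = r ⊗ (v ⊗ r′)} (∈-⊙⁺ r∈ vr′∈)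
        (subst (Sub._∈ S ⊙ S ⊙ S) (begin
          r′ ⊗ ((a ⁻¹ ⊕ ⊖ (a′ ⁻¹)) ⊗ r)  ≡⟨ cong (λ u → r′ ⊗ (u ⊗ r)) eq ⟩
          r′ ⊗ ((y ⊗ v) ⊗ r)
            ≡⟨ solve 4 (λ r r′ y v → r′ :* ((y :* v) :* r) := y :* (r :* (v :* r′))) refl r r′ y v ⟩
          y ⊗ (r ⊗ (v ⊗ r′))             ∎) (∈-⊙⁺ r′∈ ur∈)))
        where
        open ≡.≡-Reasoning
        v = b′ ⁻¹ ⊕ ⊖ (b ⁻¹)

    -- The bound on `D` turns the hypothesis into `2 * d + 3 ≤ n`. Of the 3, two units pay for the
    -- excluded direction 0 and one makes the inequality strict.
    directions-many : 0 ℕ.< ∣ S ∣ → 2 ℕ.* ∣ S ⊙ S ∣ ℕ.^ 6 ℕ.+ 3 ℕ.* ∣ S ∣ ℕ.^ 5 ℕ.≤ n ℕ.* ∣ S ∣ ℕ.^ 5 →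
      n ℕ.< 2 ℕ.* length directions
    directions-many 0<S bound = begin-strict
      n                               <⟨ ℕ.m+n≤o⇒m≤o∸n (suc n) count ⟩
      2 ℕ.* n ℕ.∸ 2 ℕ.* (1 ℕ.+ d)     ≡⟨ ℕ.*-distribˡ-∸ 2 n (1 ℕ.+ d) ⟨
      2 ℕ.* (n ℕ.∸ (1 ℕ.+ d))         ≤⟨ ℕ.*-monoʳ-≤ 2 (ℕ.∸-monoʳ-≤ n size) ⟩
      2 ℕ.* (n ℕ.∸ ∣ ⁅ 𝟘 ⁆ ∪ D ∣)
        ≡⟨ cong (2 ℕ.*_) (≡.trans (length-toList (∁ (⁅ 𝟘 ⁆ ∪ D))) (Sub.∣∁p∣≡n∸∣p∣ (⁅ 𝟘 ⁆ ∪ D))) ⟨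
      2 ℕ.* length directions         ∎
      where
      open ℕ.≤-Reasoning
      open +-*-Solver using (con) renaming (solve to solveℕ; _:=_ to _:≡_; _:+_ to _⊞_; _:*_ to _⊠_)
      d = ∣ D ∣
      s⁵ = ∣ S ∣ ℕ.^ 5
      size : ∣ ⁅ 𝟘 ⁆ ∪ D ∣ ℕ.≤ 1 ℕ.+ d
      size = begin
        ∣ ⁅ 𝟘 ⁆ ∪ D ∣                      ≤⟨ ℕ.m≤m+n _ _ ⟩
        ∣ ⁅ 𝟘 ⁆ ∪ D ∣ ℕ.+ ∣ ⁅ 𝟘 ⁆ ∩ D ∣    ≡⟨ ∣p∪q∣+∣p∩q∣ ⁅ 𝟘 ⁆ D ⟩
        ∣ ⁅ 𝟘 ⁆ ∣ ℕ.+ d                    ≡⟨ cong (ℕ._+ d) (Sub.∣⁅x⁆∣≡1 𝟘) ⟩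
        1 ℕ.+ d                            ∎
      2d+3≤n : 2 ℕ.* d ℕ.+ 3 ℕ.≤ n
      2d+3≤n = ℕ.*-cancelʳ-≤ _ _ s⁵ {{ℕ.>-nonZero (ℕ.m^n>0 ∣ S ∣ {{ℕ.>-nonZero 0<S}} 5)}} (begin
        (2 ℕ.* d ℕ.+ 3) ℕ.* s⁵
          ≡⟨ solveℕ 2 (λ d s → (con 2 ⊠ d ⊞ con 3) ⊠ s :≡ con 2 ⊠ (d ⊠ s) ⊞ con 3 ⊠ s) refl d s⁵ ⟩
        2 ℕ.* (d ℕ.* s⁵) ℕ.+ 3 ℕ.* s⁵
          ≤⟨ ℕ.+-monoˡ-≤ (3 ℕ.* s⁵) (ℕ.*-monoʳ-≤ 2 (pluennecke-ruzsa S 0<S (nonzero⇒cancellable ∘ 0∉S))) ⟩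
        2 ℕ.* ∣ S ⊙ S ∣ ℕ.^ 6 ℕ.+ 3 ℕ.* s⁵   ≤⟨ bound ⟩
        n ℕ.* s⁵                           ∎)
      count : suc n ℕ.+ 2 ℕ.* (1 ℕ.+ d) ℕ.≤ 2 ℕ.* n
      count = begin
        suc n ℕ.+ 2 ℕ.* (1 ℕ.+ d)
          ≡⟨ solveℕ 2 (λ n d → (con 1 ⊞ n) ⊞ con 2 ⊠ (con 1 ⊞ d) :≡ n ⊞ (con 2 ⊠ d ⊞ con 3)) refl n d ⟩
        n ℕ.+ (2 ℕ.* d ℕ.+ 3)      ≤⟨ ℕ.+-monoʳ-≤ n 2d+3≤n ⟩
        n ℕ.+ n                    ≡⟨ cong (n ℕ.+_) (ℕ.+-identityʳ n) ⟨
        2 ℕ.* n                    ∎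

-- The subfield as the fixed points of the q-th power map

module _ {c ℓ : Level} {p-1 k n : ℕ} (prime : Prime (suc p-1)) (n≡q² : n ≡ (suc p-1 ℕ.^ k) ℕ.^ 2)
         (F : FiniteField c ℓ n) where

  open Transport F
  private
    module F = FiniteField F
    q : ℕ
    q = suc p-1 ℕ.^ k
    order : length (allFin n) ≡ q ℕ.^ 2
    order = ≡.trans (length-tabulate id) n≡q²

  fixed-0 : 𝟘 ^ᶠ q ≡ 𝟘
  fixed-0 = 0^ (ℕ.m^n>0 (suc p-1) k)

  fixed-⊕ : ∀ {i j} → i ^ᶠ q ≡ i → j ^ᶠ q ≡ j → (i ⊕ j) ^ᶠ q ≡ i ⊕ j
  fixed-⊕ {i} {j} i^ j^ = ≡.trans (frobenius {k = k} prime order k i j) (cong₂ _⊕_ i^ j^)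

  fixed-⊖ : ∀ {i} → i ^ᶠ q ≡ i → (⊖ i) ^ᶠ q ≡ ⊖ i
  fixed-⊖ {i} i^ = +-cancelˡ i _ _ (begin
    i ⊕ (⊖ i) ^ᶠ q          ≡⟨ cong (_⊕ (⊖ i) ^ᶠ q) i^ ⟨
    i ^ᶠ q ⊕ (⊖ i) ^ᶠ q     ≡⟨ frobenius {k = k} prime order k i (⊖ i) ⟨
    (i ⊕ ⊖ i) ^ᶠ q          ≡⟨ cong (_^ᶠ q) (⊖-inverseʳ i) ⟩
    𝟘 ^ᶠ q                  ≡⟨ fixed-0 ⟩
    𝟘                       ≡⟨ ⊖-inverseʳ i ⟨
    i ⊕ ⊖ i                 ∎)
    where open ≡.≡-Reasoning

  fixed-⊗ : ∀ {i j} → i ^ᶠ q ≡ i → j ^ᶠ q ≡ j → (i ⊗ j) ^ᶠ q ≡ i ⊗ j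
  fixed-⊗ {i} {j} i^ j^ = ≡.trans (^-distrib-* i j q) (cong₂ _⊗_ i^ j^)

  fixed-inverse : ∀ {i j} → i ^ᶠ q ≡ i → i ⊗ j ≡ 𝟙 → j ^ᶠ q ≡ j
  fixed-inverse {i} {j} i^ ij≡1 = *-cancelˡ i≢0 (begin
    i ⊗ j ^ᶠ q         ≡⟨ cong (_⊗ j ^ᶠ q) i^ ⟨
    i ^ᶠ q ⊗ j ^ᶠ q    ≡⟨ ^-distrib-* i j q ⟨
    (i ⊗ j) ^ᶠ q       ≡⟨ cong (_^ᶠ q) ij≡1 ⟩
    𝟙 ^ᶠ q             ≡⟨ 1^ q ⟩
    𝟙                  ≡⟨ ij≡1 ⟨
    i ⊗ j              ∎)
    where
    open ≡.≡-Reasoning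
    i≢0 : i ≢ 𝟘
    i≢0 refl = 𝟘≢𝟙 (≡.trans (sym (⊗-zeroˡ j)) ij≡1)

  -- The nonzero elements of `L` are permuted by multiplication with any one of them, so Fermat's
  -- argument applies to the q - 1 of them.
  subfield⇒fixed : ∀ {L} → IsSubfield F L → ∣ L ∣ ≡ q → ∀ {i} → i Sub.∈ L → i ^ᶠ q ≡ i
  subfield⇒fixed {L} isSubfield ∣L∣≡q {i} i∈ with i ≟ᶠ 𝟘
  ... | yes refl = fixed-0
  ... | no  i≢0  with ∈⇒↭∷ (∈-toList⁺ (IsSubfield.0∈K isSubfield))
  ... | us , L↭ = begin
    i ^ᶠ q              ≡⟨ cong (i ^ᶠ_) (≡.trans (sym ∣L∣≡q) (≡.trans (sym (length-toList L)) (↭-length L↭))) ⟩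
    i ⊗ i ^ᶠ length us  ≡⟨ cong (i ⊗_) (*-closed⇒^≡1 us! us≢0 i≢0 closed) ⟩
    i ⊗ 𝟙               ≡⟨ ⊗-identityʳ i ⟩
    i                   ∎
    where
    open ≡.≡-Reasoning
    0∷us! : Unique (𝟘 ∷ us)
    0∷us! = Unique-resp-↭ L↭ (toList-Unique L)
    us! : Unique us
    us! with _ ∷ u ← 0∷us! = u
    us≢0 : ∀ {x} → x ∈ us → x ≢ 𝟘
    us≢0 x∈ refl = Unique[x∷xs]⇒x∉xs 0∷us! x∈
    member : ∀ {x} → x Sub.∈ L → Member F L (F.element x)
    member {x} = subst (Sub._∈ L) (sym (index-element x))
    closed : ∀ {x} → x ∈ us → (i ⊗ x) ∈ us
    closed x∈ = ∈-∷⁻ (∈-resp-↭ L↭ (∈-toList⁺ (IsSubfield.*-closed isSubfield (member i∈)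
      (member (∈-toList⁻ L (∈-resp-↭ (↭-sym L↭) (there x∈))))))) (*≢0 i≢0 (us≢0 x∈))

  -- Fixed points are closed under the field operations, under addition and negation by the
  -- Frobenius identity. Every subfield of order `q` consists of fixed points, so it lies in `A` and
  -- equals it by cardinality.
  fixed⇒theSubfield : ∀ A → (∀ {i} → i Sub.∈ A → i ^ᶠ q ≡ i) → (∀ {i} → i ^ᶠ q ≡ i → i Sub.∈ A) →
    ∣ A ∣ ≡ q → IsTheSubfieldOfOrder F q A
  fixed⇒theSubfield A to from ∣A∣≡q = record
    { isSubfield = record
      { 0∈K        = from fixed-0
      ; 1∈K        = from (1^ q)
      ; +-closed   = λ {x} {y} x∈ y∈ → subst (Sub._∈ A) (sym (index-+ x y)) (from (fixed-⊕ (to x∈) (to y∈)))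
      ; neg-closed = λ {x} x∈ → subst (Sub._∈ A) (sym (index-neg x)) (from (fixed-⊖ (to x∈)))
      ; *-closed   = λ {x} {y} x∈ y∈ → subst (Sub._∈ A) (sym (index-* x y)) (from (fixed-⊗ (to x∈) (to y∈)))
      ; inv-closed = λ {x} {y} x∈ xy≈1 → from (fixed-inverse (to x∈) (≡.trans (sym (index-* x y)) (index-cong xy≈1)))
      }
    ; order  = ∣A∣≡q
    ; unique = λ L isSubfield ∣L∣≡q → p⊆q∧∣q∣≤∣p∣⇒p≡q (from ∘ subfield⇒fixed isSubfield ∣L∣≡q)
                 (ℕ.≤-reflexive (≡.trans ∣A∣≡q (sym ∣L∣≡q)))
    }

  clique⇒theSubfield : ∀ (S A : Subset n) → 0 ℕ.< ∣ S ∣ → (∀ {x} → Member F S x → ¬ (x F.≈ F.0#)) →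
    2 ℕ.* ∣ productSet F S S ∣ ℕ.^ 6 ℕ.+ 3 ℕ.* ∣ S ∣ ℕ.^ 5 ℕ.≤ n ℕ.* ∣ S ∣ ℕ.^ 5 →
    IsClique F._≈_ (Cay F.+-abelianGroup (Member F S)) (Member F A) →
    ∣ A ∣ ≡ q → Member F A F.0# → Member F A F.1# → IsTheSubfieldOfOrder F q A
  clique⇒theSubfield S A 0<S 0∉S bound clique ∣A∣≡q 0∈A 1∈A =
    fixed⇒theSubfield A (∈-fixed ∘ ∈-toList⁺) (∈-toList⁻ A ∘ fixed-∈) ∣A∣≡q
    where
    0∉S′ : ∀ {i} → i Sub.∈ S → i ≢ 𝟘
    0∉S′ i∈ refl = 0∉S i∈ F.refl

    clique′ : ∀ {i j} → i Sub.∈ A → j Sub.∈ A → i ≢ j → (i ⊕ ⊖ j) Sub.∈ S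
    clique′ {i} {j} i∈ j∈ i≢j = subst (Sub._∈ S) (index-cong (F.+-congˡ (F.sym (element-index _))))
      (clique (subst (Sub._∈ A) (sym (index-element i)) i∈) (subst (Sub._∈ A) (sym (index-element j)) j∈)
        (i≢j ∘ λ eq → ≡.trans (sym (index-element i)) (≡.trans (index-cong eq) (index-element j))))

    open Clique S 0∉S′ A 0∈A clique′

    s∈S : ∃ λ s → s Sub.∈ S
    s∈S with toList S in eq
    ... | []    = contradiction (≡.trans (sym (length-toList S)) (cong length eq)) (ℕ.m<n⇒n≢0 0<S)
    ... | s ∷ _ = s , ∈-toList⁻ S (subst (s ∈_) (sym eq) (here refl))

    many : length (allFin n) ℕ.< 2 ℕ.* length directions
    many = subst (ℕ._< 2 ℕ.* length directions) (sym (length-tabulate id)) (directions-many 0<S bound)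

    ∈-fixed : ∀ {i} → i ∈ toList A → i ^ᶠ q ≡ i
    ∈-fixed = ∈⇒fixed {k = k} prime order (toList-Unique A) (≡.trans (length-toList A) ∣A∣≡q)
      (∈-toList⁺ 0∈A) (∈-toList⁺ 1∈A) directions! many (A-transversal (proj₂ s∈S)) A⁻¹-transversal

    fixed-∈ : ∀ {i} → i ^ᶠ q ≡ i → i ∈ toList A
    fixed-∈ = fixed⇒∈ {k = k} prime order (toList-Unique A) (≡.trans (length-toList A) ∣A∣≡q)
      (∈-toList⁺ 0∈A) (∈-toList⁺ 1∈A) directions! many (A-transversal (proj₂ s∈S)) A⁻¹-transversal

open import Data.Integer.Base using (+_; _-_)
open import Data.Nat.Base using (NonZero; _^_)
open import Data.Rational.Base using (_/_; _≤_; _*_)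

corollary1p2 : ∀ {c ℓ} (q : ℕ) → IsPrimePower q →
    (F : FiniteField c ℓ (q ^ 2)) →
    let module F = FiniteField F in
    (S : Subset (q ^ 2)) .{{_ : NonZero ∣ S ∣}} →
    (∀ {x} → Member F S x → ¬ (x F.≈ F.0#)) →
    S ≡ negSet F S →
    (let C = + ∣ productSet F S S ∣ / ∣ S ∣ in
    (C ^ℚ 6) * (+ ∣ S ∣ / 1) ≤ (+ (q ^ 2) - + 3) / 2) →
    (A : Subset (q ^ 2)) →
    IsClique F._≈_ (Cay F.+-abelianGroup (Member F S)) (Member F A) →
    ∣ A ∣ ≡ q →
    Member F A F.0# →
    Member F A F.1# →
    IsTheSubfieldOfOrder F q A
corollary1p2 _ (zero    , _ , 0-prime , _)    = contradiction 0-prime ¬prime[0]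
corollary1p2 q (suc p-1 , k , p-prime , refl) F S 0∉S _ bound A clique =
  clique⇒theSubfield {k = suc k} p-prime refl F S A (ℕ.>-nonZero⁻¹ ∣ S ∣) 0∉S
    (clear-denominators ∣ productSet F S S ∣ ∣ S ∣ (q ^ 2) bound) clique
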